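{- Let $R$ be an SMLL net and $M_R$ its multitoken machine. All runs of $M_R$ from the initial state $\mathbf{I}_R$ terminate on a final state $\mathbf{F}_R$, and this final state is unique.
   Context: SMLL formulas: $A ::= 1 \mid \bot \mid X \mid X^\bot \mid A\otimes A \mid A ⅋ A$ (⅋ is "par"), involutive negation; positive $P ::= 1\mid P\otimes P$, negative $N ::= \bot\mid N ⅋ N$. SMLL nets: axiom, cut, $\otimes$, ⅋, one, bot links (each bot link with a box of conclusions $\bot,\Gamma$, $\bot$ its lock) and $n$-ary sync links on positive or negative formulas (in-edges: positive premisses and negative conclusions; out-edges: positive conclusions and negative premisses), with no cyclic switching path (using at most one premiss of each ⅋ and one out-edge of each sync link) at depth 0, recursively in boxes. The SIAM $M_R$: positions are pairs $(e,m)$ ($e$ an edge, $m$ the address in $\{\mathbf{l},\mathbf{r}\}^*$ of an atom occurrence in its type) and $(e,i)$, $i\in\mathbb{N}$, $e$ a box lock; INIT$(R)$/FIN$(R)$ are the negative/positive atom occurrences in conclusions of $R$, ONES$(R)$ positions on conclusions of one links, BOTBOX$(R)$ positions $(e,i)$ on locks. States are functions $\mathbf{T}:\mathrm{INIT}(R)\cup L\to\mathrm{POS}(R)$, $L\subseteq\mathrm{ONES}(R)$; initial state $\mathbf{I}_R$ = identity on INIT$(R)$; a state is final if its image is FIN$(R)\cup B$, $B\subseteq$ BOTBOX$(R)$. Transitions: tokens move up on negative and down on positive positions, pass through axioms and cuts to the dual edge, add/strip $\mathbf{l},\mathbf{r}$ at $\otimes$/⅋ links, cross a sync link all simultaneously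 only when all positions of its in-edges are occupied; a new token may be created on the conclusion of an active one link (depth 0, or depth 0 in an unlocked box); a token on a lock $(e,\varepsilon)$ becomes $(e,0)$, unlocking the box; tokens enter a box only if it is unlocked. A run is a maximal sequence of transitions from $\mathbf{I}_R$. -}

module Defs where

open import Data.Nat using (ℕ; zero; suc; _≤_; _<_)
open import Data.Fin using (Fin)
open import Data.List using (List; []; _∷_; map)
open import Data.List.Membership.Propositional using (_∈_)
open import Data.List.Relation.Unary.Unique.Propositional using (Unique)
open import Data.List.Relation.Unary.All using (All)
open import Data.Maybe using (Maybe; just; nothing)
open import Data.Product using (Σ; ∃; _×_; _,_; proj₁; proj₂)
open import Data.Sum using (_⊎_)
open import Data.Empty using (⊥)
open import Relation.Nullary using (¬_)
open import Relation.Binary.PropositionalEquality using (_≡_; _≢_)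

data Formula : Set where
  One  : Formula
  Bot  : Formula
  X    : ℕ → Formula
  X⊥   : ℕ → Formula
  _⊗_  : Formula → Formula → Formula
  _⅋_  : Formula → Formula → Formula

dual : Formula → Formula
dual One = Bot
dual Bot = One
dual (X x) = X⊥ x
dual (X⊥ x) = X x
dual (A ⊗ B) = dual A ⅋ dual B
dual (A ⅋ B) = dual A ⊗ dual B

data IsP : Formula → Set where
  p-one : IsP One
  p-⊗   : ∀ {A B} → IsP A → IsP B → IsP (A ⊗ B)

data IsN : Formula → Set where
  n-bot : IsN Bot
  n-⅋   : ∀ {A B} → IsN A → IsN B → IsN (A ⅋ B)

data Dir : Set where
  𝐥 𝐫 : Dir

Addr : Set
Addr = List Dir

sub : Formula → Addr → Maybe Formula
sub A [] = just A
sub (A ⊗ B) (𝐥 ∷ m) = sub A m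
sub (A ⊗ B) (𝐫 ∷ m) = sub B m
sub (A ⅋ B) (𝐥 ∷ m) = sub A m
sub (A ⅋ B) (𝐫 ∷ m) = sub B m
sub One (_ ∷ _) = nothing
sub Bot (_ ∷ _) = nothing
sub (X _) (_ ∷ _) = nothing
sub (X⊥ _) (_ ∷ _) = nothing

data PosAtom : Formula → Set where
  pa-one : PosAtom One
  pa-X   : ∀ x → PosAtom (X x)

data NegAtom : Formula → Set where
  na-bot : NegAtom Bot
  na-X⊥  : ∀ x → NegAtom (X⊥ x)

PosOcc : Formula → Addr → Set
PosOcc A m = Σ Formula λ a → sub A m ≡ just a × PosAtom a

NegOcc : Formula → Addr → Set
NegOcc A m = Σ Formula λ a → sub A m ≡ just a × NegAtom a

AtomOcc : Formula → Addr → Set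
AtomOcc A m = PosOcc A m ⊎ NegOcc A m

data Link (E : Set) : Set where
  axL   : E → E → Link E
  cutL  : E → E → Link E
  tensL : E → E → E → Link E
  parL  : E → E → E → Link E
  oneL  : E → Link E
  botL  : E → Link E                -- conclusion (the lock of its box)
  syncL : List (E × E) → Link E

prems : ∀ {E} → Link E → List E
prems (axL a b) = []
prems (cutL a b) = a ∷ b ∷ []
prems (tensL a b c) = a ∷ b ∷ []
prems (parL a b c) = a ∷ b ∷ []
prems (oneL e) = []
prems (botL e) = []
prems (syncL ps) = map proj₁ ps

concls : ∀ {E} → Link E → List E
concls (axL a b) = a ∷ b ∷ []
concls (cutL a b) = []
concls (tensL a b c) = c ∷ []
concls (parL a b c) = c ∷ []
concls (oneL e) = e ∷ []
concls (botL e) = e ∷ []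
concls (syncL ps) = map proj₂ ps

data NonEmpty {A : Set} : List A → Set where
  nonEmpty : ∀ x xs → NonEmpty (x ∷ xs)

LinkTyped : ∀ {E} → (E → Formula) → Link E → Set
LinkTyped ty (axL a b) = ty b ≡ dual (ty a)
LinkTyped ty (cutL a b) = ty b ≡ dual (ty a)
LinkTyped ty (tensL a b c) = ty c ≡ (ty a ⊗ ty b)
LinkTyped ty (parL a b c) = ty c ≡ (ty a ⅋ ty b)
LinkTyped ty (oneL e) = ty e ≡ One
LinkTyped ty (botL e) = ty e ≡ Bot
LinkTyped ty (syncL ps) =
  NonEmpty ps ×
  All (λ pc → ty (proj₁ pc) ≡ ty (proj₂ pc) × (IsP (ty (proj₁ pc)) ⊎ IsN (ty (proj₁ pc)))) ps

-- Nets (flat representation with box nesting)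
--   parent l = just b : the link l lies (immediately) in the box of the bot link b
--   parent l = nothing : l is at depth 0

record Net : Set where
  field
    nE     : ℕ
    nL     : ℕ
    ty     : Fin nE → Formula
    link   : Fin nL → Link (Fin nE)
    parent : Fin nL → Maybe (Fin nL)

module _ (R : Net) where
  open Net R

  IsBotLink : Fin nL → Set
  IsBotLink b = Σ (Fin nE) λ e → link b ≡ botL e

  data Inside : Fin nL → Fin nL → Set where
    here  : ∀ {l b} → parent l ≡ just b → Inside l b
    there : ∀ {l c b} → parent l ≡ just c → Inside c b → Inside l b

  IsConclusion : Fin nE → Set
  IsConclusion e = ∀ l → ¬ (e ∈ prems (link l))

  InOut : Fin nE × Fin nE → Fin nE → Fin nE → Set
  InOut (p , c) i o = (IsP (ty p) × i ≡ p × o ≡ c) ⊎ (IsN (ty p) × i ≡ c × o ≡ p)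

  OutEdgeOf : Fin nL → Fin nE → Set
  OutEdgeOf s o = Σ (List (Fin nE × Fin nE)) λ ps → link s ≡ syncL ps ×
                    Σ (Fin nE × Fin nE) λ pc → pc ∈ ps × Σ (Fin nE) λ i → InOut pc i o

  -- at level lv (nothing = depth 0 of R, just b = depth 0 of the box of b),
  -- the node representing the link p: itself if it is at level lv, or the
  -- bot link of the box at level lv containing it.
  Rep : Maybe (Fin nL) → Fin nL → Fin nL → Set
  Rep lv p r = (parent p ≡ lv × r ≡ p) ⊎ (parent r ≡ lv × Inside p r)

  Joins : Maybe (Fin nL) → Fin nE → Fin nL → Fin nL → Set
  Joins lv e u v = Σ (Fin nL) λ c → Σ (Fin nL) λ p →
    e ∈ prems (link c) × parent c ≡ lv × e ∈ concls (link p) ×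
    ((Rep lv p u × v ≡ c) ⊎ (Rep lv p v × u ≡ c))

  record SwitchingCycle (lv : Maybe (Fin nL)) : Set where
    field
      len        : ℕ
      edge       : ℕ → Fin nE
      node       : ℕ → Fin nL
      joins      : ∀ i → i ≤ len → Joins lv (edge i) (node i) (node (suc i))
      closed     : node (suc len) ≡ node 0
      distinct   : ∀ i j → i ≤ len → j ≤ len → edge i ≡ edge j → i ≡ j
      parSwitch  : ∀ i j l a b c → i ≤ len → j ≤ len → link l ≡ parL a b c →
                   edge i ∈ (a ∷ b ∷ []) → edge j ∈ (a ∷ b ∷ []) → i ≡ j
      syncSwitch : ∀ i j s → i ≤ len → j ≤ len → parent s ≡ lv →
                   OutEdgeOf s (edge i) → OutEdgeOf s (edge j) → i ≡ j

  record IsSMLLNet : Set where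
    field
      typed          : ∀ l → LinkTyped ty (link l)
      conclsUnique   : ∀ l → Unique (concls (link l))
      premsUnique    : ∀ l → Unique (prems (link l))
      producer       : ∀ e → Σ (Fin nL) λ l → e ∈ concls (link l)
      producerUnique : ∀ e l l' → e ∈ concls (link l) → e ∈ concls (link l') → l ≡ l'
      consumerUnique : ∀ e l l' → e ∈ prems (link l) → e ∈ prems (link l') → l ≡ l'
      parentBot      : ∀ l b → parent l ≡ just b → IsBotLink b
      nestingAcyclic : ∀ l → ¬ Inside l l
      boxClosed      : ∀ l l' e b → e ∈ prems (link l) → e ∈ concls (link l') →
                       Inside l b → Inside l' b
      correct        : ∀ lv → ¬ SwitchingCycle lv

  data Position : Set where
    pos     : Fin nE → Addr → Position
    lockPos : Fin nE → ℕ → Position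

  INIT : Position → Set
  INIT p = Σ (Fin nE) λ e → Σ Addr λ m → p ≡ pos e m × IsConclusion e × NegOcc (ty e) m

  FIN : Position → Set
  FIN p = Σ (Fin nE) λ e → Σ Addr λ m → p ≡ pos e m × IsConclusion e × PosOcc (ty e) m

  ONES : Position → Set
  ONES p = Σ (Fin nL) λ o → Σ (Fin nE) λ e → link o ≡ oneL e × p ≡ pos e []

  BOTBOX : Position → Set
  BOTBOX p = Σ (Fin nL) λ b → Σ (Fin nE) λ e → Σ ℕ λ i → link b ≡ botL e × p ≡ lockPos e i

  -- a state maps token names (positions in INIT ∪ L, L ⊆ ONES) to positions;
  -- T n ≡ nothing means n is not (yet) in the domain
  State : Set
  State = Position → Maybe Position

  IsInitial : State → Set
  IsInitial T = ∀ n → (INIT n → T n ≡ just n) × (¬ INIT n → T n ≡ nothing)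

  IsFinal : State → Set
  IsFinal T = (∀ n p → T n ≡ just p → FIN p ⊎ BOTBOX p) ×
              (∀ p → FIN p → Σ Position λ n → T n ≡ just p)

  Unlocked : State → Fin nL → Set
  Unlocked T b = Σ (Fin nE) λ e → link b ≡ botL e ×
                 Σ Position λ n → Σ ℕ λ i → T n ≡ just (lockPos e i)

  BoxesOpen : State → Fin nL → Set
  BoxesOpen T l = ∀ b → Inside l b → Unlocked T b

  data Through (l : Fin nL) : Position → Position → Set where
    tens-down-l : ∀ {a b c m} → link l ≡ tensL a b c → PosOcc (ty a) m →
                  Through l (pos a m) (pos c (𝐥 ∷ m))
    tens-down-r : ∀ {a b c m} → link l ≡ tensL a b c → PosOcc (ty b) m →
                  Through l (pos b m) (pos c (𝐫 ∷ m))
    par-down-l  : ∀ {a b c m} → link l ≡ parL a b c → PosOcc (ty a) m →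
                  Through l (pos a m) (pos c (𝐥 ∷ m))
    par-down-r  : ∀ {a b c m} → link l ≡ parL a b c → PosOcc (ty b) m →
                  Through l (pos b m) (pos c (𝐫 ∷ m))
    tens-up-l   : ∀ {a b c m} → link l ≡ tensL a b c → NegOcc (ty c) (𝐥 ∷ m) →
                  Through l (pos c (𝐥 ∷ m)) (pos a m)
    tens-up-r   : ∀ {a b c m} → link l ≡ tensL a b c → NegOcc (ty c) (𝐫 ∷ m) →
                  Through l (pos c (𝐫 ∷ m)) (pos b m)
    par-up-l    : ∀ {a b c m} → link l ≡ parL a b c → NegOcc (ty c) (𝐥 ∷ m) →
                  Through l (pos c (𝐥 ∷ m)) (pos a m)
    par-up-r    : ∀ {a b c m} → link l ≡ parL a b c → NegOcc (ty c) (𝐫 ∷ m) →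
                  Through l (pos c (𝐫 ∷ m)) (pos b m)
    cut-l       : ∀ {a b m} → link l ≡ cutL a b → PosOcc (ty a) m →
                  Through l (pos a m) (pos b m)
    cut-r       : ∀ {a b m} → link l ≡ cutL a b → PosOcc (ty b) m →
                  Through l (pos b m) (pos a m)
    ax-l        : ∀ {a b m} → link l ≡ axL a b → NegOcc (ty a) m →
                  Through l (pos a m) (pos b m)
    ax-r        : ∀ {a b m} → link l ≡ axL a b → NegOcc (ty b) m →
                  Through l (pos b m) (pos a m)
    lock        : ∀ {e} → link l ≡ botL e →
                  Through l (pos e []) (lockPos e 0)

  OnInEdge : List (Fin nE × Fin nE) → Position → Set
  OnInEdge ps q = Σ (Fin nE × Fin nE) λ pc → pc ∈ ps × Σ (Fin nE) λ i → Σ (Fin nE) λ o →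
                  InOut pc i o × Σ Addr λ m → q ≡ pos i m

  data Step (T T' : State) : Set where
    move   : ∀ l n p p' → T n ≡ just p → Through l p p' → BoxesOpen T l →
             T' n ≡ just p' → (∀ n' → n' ≢ n → T' n' ≡ T n') → Step T T'
    sync   : ∀ s ps → link s ≡ syncL ps → BoxesOpen T s →
             (∀ pc → pc ∈ ps → ∀ i o → InOut pc i o → ∀ m → AtomOcc (ty i) m →
                Σ Position λ n → T n ≡ just (pos i m)) →
             (∀ n → (Σ (Fin nE × Fin nE) λ pc → pc ∈ ps × Σ (Fin nE) λ i → Σ (Fin nE) λ o →
                       InOut pc i o × Σ Addr λ m → T n ≡ just (pos i m) × T' n ≡ just (pos o m))
                    ⊎ ((∀ q → T n ≡ just q → ¬ OnInEdge ps q) × T' n ≡ T n)) →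
             Step T T'
    create : ∀ o e → link o ≡ oneL e → T (pos e []) ≡ nothing → BoxesOpen T o →
             T' (pos e []) ≡ just (pos e []) →
             (∀ n' → n' ≢ pos e [] → T' n' ≡ T n') → Step T T'

  record MaximalRun : Set where
    field
      len   : ℕ
      st    : ℕ → State
      start : IsInitial (st 0)
      steps : ∀ i → i < len → Step (st i) (st (suc i))
      stuck : ∀ T' → ¬ Step (st len) T'

  lastState : MaximalRun → State
  lastState ρ = MaximalRun.st ρ (MaximalRun.len ρ)

  InfiniteRun : Set
  InfiniteRun = Σ (ℕ → State) λ f → IsInitial (f 0) × (∀ i → Step (f i) (f (suc i)))

{-# OPTIONS --safe #-}
-- The wires inside the links match atom occurrences in pairs, so the moves of a token form a
-- partial injection on positions, and no move leads to the starting position of a token.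
-- Hence no position is ever visited twice and all runs are finite.
--
-- For deadlock freedom, label every edge of a stuck state in the style of Retoré's proof that
-- proof nets denote cliques of coherence spaces: an unvisited positive atom is labelled "up"
-- and an unvisited negative atom "down", up wins at ⊗ and down wins at ⅋.  Following up-edges
-- upwards and down-edges downwards gives a switching path at the current nesting level (a sync
-- link is entered through an out-edge and left through an in-edge, a locked box is left through
-- its lock, and the path through an unlocked box is found by induction on nesting).  The path
-- can only end in a down-labelled conclusion, but the negative atoms of conclusions are visited
-- from the start; otherwise it closes a switching cycle.  So all positions have been visited and
-- all boxes are unlocked.  The last position of each token is then the end of the unique maximal
-- sequence of moves from its starting position, which gives uniqueness.
module Submission where

open import Defs
open import Data.Bool using (Bool; true; false)
open import Data.Empty using (⊥; ⊥-elim)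
open import Data.Fin using (Fin; toℕ)
open import Data.Fin.Induction using (spo-wellFounded; spo-noetherian)
import Data.Fin.Properties as Fin
open import Data.List using (List; []; _∷_; _++_; map; concatMap; allFin; filter; length)
open import Data.List.Membership.Propositional using (_∈_; lose; find)
open import Data.List.Membership.Propositional.Properties using (∈-map⁺; ∈-map⁻; ∈-++⁺ˡ; ∈-++⁺ʳ; ∈-concatMap⁺; ∈-allFin; ∈-filter⁺)
import Data.List.Membership.DecPropositional as DecMembership
open import Data.List.Properties using (≡-dec; filter-notAll)
open import Data.List.Relation.Unary.All as All using (All; []; _∷_)
open import Data.List.Relation.Unary.AllPairs using ([]; _∷_)
open import Data.List.Relation.Unary.Any as Any using (here; there)
open import Data.List.Relation.Unary.Unique.Propositional using (Unique)
open import Data.Maybe using (Maybe; just; nothing)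
import Data.Maybe.Properties as Maybe
open import Data.Maybe.Properties using (just-injective)
open import Data.Nat as ℕ using (ℕ; zero; suc)
import Data.Nat.Properties as ℕ
open import Data.Product using (Σ; ∃; ∃₂; _×_; _,_; proj₁; proj₂)
open import Data.Sum using (_⊎_; inj₁; inj₂; [_,_]; swap)
open import Data.Unit using (⊤; tt)
open import Function using (_∘_; flip; mk⇔)
open import Induction.WellFounded using (WellFounded; Acc; acc)
open import Relation.Binary.Construct.Closure.ReflexiveTransitive using (Star; ε; _◅_; _◅◅_)
open import Relation.Binary.Definitions using (DecidableEquality)
open import Relation.Binary.PropositionalEquality using (_≡_; _≢_; refl; sym; trans; cong; cong₂; subst; isEquivalence)
open import Relation.Binary.Structures using (IsStrictPartialOrder)
open import Relation.Nullary using (¬_; Dec; yes; no; does)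
open import Relation.Nullary.Decidable using (map′; _×-dec_; _⊎-dec_; _→-dec_; ¬?; does-⇔; dec-true)

-- Atom occurrences

polarity-exclusive : ∀ A m → PosOcc A m → ¬ NegOcc A m
polarity-exclusive A m (a , eq , p) (b , eq′ , n) with just-injective (trans (sym eq) eq′)
polarity-exclusive A m (_ , eq , pa-one) (_ , eq′ , ()) | refl
polarity-exclusive A m (_ , eq , pa-X x) (_ , eq′ , ()) | refl

posOcc? : ∀ A m → Dec (PosOcc A m)
posOcc? A m with sub A m
... | just One = yes (One , refl , pa-one)
... | just Bot = no λ { (_ , refl , ()) }
... | just (X x) = yes (X x , refl , pa-X x)
... | just (X⊥ x) = no λ { (_ , refl , ()) }
... | just (_ ⊗ _) = no λ { (_ , refl , ()) }
... | just (_ ⅋ _) = no λ { (_ , refl , ()) }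
... | nothing = no λ { (_ , () , _) }

dual-involutive : ∀ A → dual (dual A) ≡ A
dual-involutive One = refl
dual-involutive Bot = refl
dual-involutive (X x) = refl
dual-involutive (X⊥ x) = refl
dual-involutive (A ⊗ B) = cong₂ _⊗_ (dual-involutive A) (dual-involutive B)
dual-involutive (A ⅋ B) = cong₂ _⅋_ (dual-involutive A) (dual-involutive B)

sub-dual : ∀ A m {a} → sub A m ≡ just a → sub (dual A) m ≡ just (dual a)
sub-dual A [] refl = refl
sub-dual (A ⊗ B) (𝐥 ∷ m) eq = sub-dual A m eq
sub-dual (A ⊗ B) (𝐫 ∷ m) eq = sub-dual B m eq
sub-dual (A ⅋ B) (𝐥 ∷ m) eq = sub-dual A m eq
sub-dual (A ⅋ B) (𝐫 ∷ m) eq = sub-dual B m eq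

PosOcc⇒NegOcc-dual : ∀ A m → PosOcc A m → NegOcc (dual A) m
PosOcc⇒NegOcc-dual A m (_ , eq , pa-one) = _ , sub-dual A m eq , na-bot
PosOcc⇒NegOcc-dual A m (_ , eq , pa-X x) = _ , sub-dual A m eq , na-X⊥ x

NegOcc⇒PosOcc-dual : ∀ A m → NegOcc A m → PosOcc (dual A) m
NegOcc⇒PosOcc-dual A m (_ , eq , na-bot) = _ , sub-dual A m eq , pa-one
NegOcc⇒PosOcc-dual A m (_ , eq , na-X⊥ x) = _ , sub-dual A m eq , pa-X x

PosOcc-dual⇒NegOcc : ∀ A m → PosOcc (dual A) m → NegOcc A m
PosOcc-dual⇒NegOcc A m o = subst (λ B → NegOcc B m) (dual-involutive A) (PosOcc⇒NegOcc-dual (dual A) m o)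

NegOcc-dual⇒PosOcc : ∀ A m → NegOcc (dual A) m → PosOcc A m
NegOcc-dual⇒PosOcc A m o = subst (λ B → PosOcc B m) (dual-involutive A) (NegOcc⇒PosOcc-dual (dual A) m o)

negOcc? : ∀ A m → Dec (NegOcc A m)
negOcc? A m = map′ (PosOcc-dual⇒NegOcc A m) (NegOcc⇒PosOcc-dual A m) (posOcc? (dual A) m)

IsP⇒¬NegOcc : ∀ {A} m → IsP A → ¬ NegOcc A m
IsP⇒¬NegOcc [] p-one (_ , refl , ())
IsP⇒¬NegOcc [] (p-⊗ _ _) (_ , refl , ())
IsP⇒¬NegOcc (𝐥 ∷ m) (p-⊗ p q) o = IsP⇒¬NegOcc m p o
IsP⇒¬NegOcc (𝐫 ∷ m) (p-⊗ p q) o = IsP⇒¬NegOcc m q o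

IsN⇒¬PosOcc : ∀ {A} m → IsN A → ¬ PosOcc A m
IsN⇒¬PosOcc [] n-bot (_ , refl , ())
IsN⇒¬PosOcc [] (n-⅋ _ _) (_ , refl , ())
IsN⇒¬PosOcc (𝐥 ∷ m) (n-⅋ p q) o = IsN⇒¬PosOcc m p o
IsN⇒¬PosOcc (𝐫 ∷ m) (n-⅋ p q) o = IsN⇒¬PosOcc m q o

IsP⇒¬IsN : ∀ {A} → IsP A → ¬ IsN A
IsP⇒¬IsN p-one ()
IsP⇒¬IsN (p-⊗ _ _) ()

someAtom : ∀ A → Σ Addr (AtomOcc A)
someAtom One = [] , inj₁ (One , refl , pa-one)
someAtom Bot = [] , inj₂ (Bot , refl , na-bot)
someAtom (X x) = [] , inj₁ (X x , refl , pa-X x)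
someAtom (X⊥ x) = [] , inj₂ (X⊥ x , refl , na-X⊥ x)
someAtom (A ⊗ B) = let m , o = someAtom A in 𝐥 ∷ m , o
someAtom (A ⅋ B) = let m , o = someAtom A in 𝐥 ∷ m , o

atoms : Formula → List Addr
atoms (A ⊗ B) = map (𝐥 ∷_) (atoms A) ++ map (𝐫 ∷_) (atoms B)
atoms (A ⅋ B) = map (𝐥 ∷_) (atoms A) ++ map (𝐫 ∷_) (atoms B)
atoms _ = [] ∷ []

AtomOcc⇒∈atoms : ∀ A m → AtomOcc A m → m ∈ atoms A
AtomOcc⇒∈atoms One [] o = here refl
AtomOcc⇒∈atoms One (_ ∷ _) (inj₁ (_ , () , _))
AtomOcc⇒∈atoms One (_ ∷ _) (inj₂ (_ , () , _))
AtomOcc⇒∈atoms Bot [] o = here refl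
AtomOcc⇒∈atoms Bot (_ ∷ _) (inj₁ (_ , () , _))
AtomOcc⇒∈atoms Bot (_ ∷ _) (inj₂ (_ , () , _))
AtomOcc⇒∈atoms (X x) [] o = here refl
AtomOcc⇒∈atoms (X x) (_ ∷ _) (inj₁ (_ , () , _))
AtomOcc⇒∈atoms (X x) (_ ∷ _) (inj₂ (_ , () , _))
AtomOcc⇒∈atoms (X⊥ x) [] o = here refl
AtomOcc⇒∈atoms (X⊥ x) (_ ∷ _) (inj₁ (_ , () , _))
AtomOcc⇒∈atoms (X⊥ x) (_ ∷ _) (inj₂ (_ , () , _))
AtomOcc⇒∈atoms (A ⊗ B) [] (inj₁ (_ , refl , ()))
AtomOcc⇒∈atoms (A ⊗ B) [] (inj₂ (_ , refl , ()))
AtomOcc⇒∈atoms (A ⊗ B) (𝐥 ∷ m) o = ∈-++⁺ˡ (∈-map⁺ (𝐥 ∷_) (AtomOcc⇒∈atoms A m o))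
AtomOcc⇒∈atoms (A ⊗ B) (𝐫 ∷ m) o = ∈-++⁺ʳ (map (𝐥 ∷_) (atoms A)) (∈-map⁺ (𝐫 ∷_) (AtomOcc⇒∈atoms B m o))
AtomOcc⇒∈atoms (A ⅋ B) [] (inj₁ (_ , refl , ()))
AtomOcc⇒∈atoms (A ⅋ B) [] (inj₂ (_ , refl , ()))
AtomOcc⇒∈atoms (A ⅋ B) (𝐥 ∷ m) o = ∈-++⁺ˡ (∈-map⁺ (𝐥 ∷_) (AtomOcc⇒∈atoms A m o))
AtomOcc⇒∈atoms (A ⅋ B) (𝐫 ∷ m) o = ∈-++⁺ʳ (map (𝐥 ∷_) (atoms A)) (∈-map⁺ (𝐫 ∷_) (AtomOcc⇒∈atoms B m o))

Dir-≟ : DecidableEquality Dir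
Dir-≟ 𝐥 𝐥 = yes refl
Dir-≟ 𝐥 𝐫 = no λ ()
Dir-≟ 𝐫 𝐥 = no λ ()
Dir-≟ 𝐫 𝐫 = yes refl

-- Sync links are the only links crossed by several tokens at once; this predicate separates them
-- from the rest without naming the list of pairs.
data IsSync {E : Set} : Link E → Set where
  isSync : ∀ {ps} → IsSync (syncL ps)

isSync? : ∀ {E} (L : Link E) → Dec (IsSync L)
isSync? (axL _ _) = no λ ()
isSync? (cutL _ _) = no λ ()
isSync? (tensL _ _ _) = no λ ()
isSync? (parL _ _ _) = no λ ()
isSync? (oneL _) = no λ ()
isSync? (botL _) = no λ ()
isSync? (syncL _) = yes isSync

module _ {A B : Set} where

  unique-map-proj₁ : ∀ {ps : List (A × B)} {a b b′} → Unique (map proj₁ ps) → (a , b) ∈ ps → (a , b′) ∈ ps → b ≡ b′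
  unique-map-proj₁ _ (here refl) (here refl) = refl
  unique-map-proj₁ (a∉ ∷ _) (here refl) (there j) = ⊥-elim (All.lookup a∉ (∈-map⁺ proj₁ j) refl)
  unique-map-proj₁ (a∉ ∷ _) (there i) (here refl) = ⊥-elim (All.lookup a∉ (∈-map⁺ proj₁ i) refl)
  unique-map-proj₁ (_ ∷ u) (there i) (there j) = unique-map-proj₁ u i j

  unique-map-proj₂ : ∀ {ps : List (A × B)} {a a′ b} → Unique (map proj₂ ps) → (a , b) ∈ ps → (a′ , b) ∈ ps → a ≡ a′
  unique-map-proj₂ _ (here refl) (here refl) = refl
  unique-map-proj₂ (b∉ ∷ _) (here refl) (there j) = ⊥-elim (All.lookup b∉ (∈-map⁺ proj₂ j) refl)
  unique-map-proj₂ (b∉ ∷ _) (there i) (here refl) = ⊥-elim (All.lookup b∉ (∈-map⁺ proj₂ i) refl)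
  unique-map-proj₂ (_ ∷ u) (there i) (there j) = unique-map-proj₂ u i j

-- A port is an atom occurrence seen from one of the two links its edge is attached to.

data Port (E : Set) : Set where
  prem concl : E → Addr → Port E
  box        : E → Port E

module _ {E : Set} where

  -- Wires are listed in one orientation each; `Wire` is the symmetric closure. At a sync link they
  -- join the two edges of a pair address by address, forgetting that tokens cross together. `lock`
  -- joins the atom of a lock to the position taken when the box is unlocked.
  data Half : Link E → Port E → Port E → Set where
    tens-l : ∀ {a b c m} → Half (tensL a b c) (prem a m) (concl c (𝐥 ∷ m))
    tens-r : ∀ {a b c m} → Half (tensL a b c) (prem b m) (concl c (𝐫 ∷ m))
    par-l  : ∀ {a b c m} → Half (parL a b c) (prem a m) (concl c (𝐥 ∷ m))
    par-r  : ∀ {a b c m} → Half (parL a b c) (prem b m) (concl c (𝐫 ∷ m))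
    ax     : ∀ {a b m} → Half (axL a b) (concl a m) (concl b m)
    cut    : ∀ {a b m} → Half (cutL a b) (prem a m) (prem b m)
    lock   : ∀ {e} → Half (botL e) (concl e []) (box e)
    sync   : ∀ {ps p c m} → (p , c) ∈ ps → Half (syncL ps) (prem p m) (concl c m)

  Wire : Link E → Port E → Port E → Set
  Wire L x y = Half L x y ⊎ Half L y x

  On : Link E → Port E → Set
  On L (prem e _) = e ∈ prems L
  On L (concl e _) = e ∈ concls L
  On L (box e) = e ∈ concls L

  half-on : ∀ {L x y} → Half L x y → On L x × On L y
  half-on tens-l = here refl , here refl
  half-on tens-r = there (here refl) , here refl
  half-on par-l = here refl , here refl
  half-on par-r = there (here refl) , here refl
  half-on ax = here refl , there (here refl)
  half-on cut = here refl , there (here refl)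
  half-on lock = here refl , here refl
  half-on (sync i) = ∈-map⁺ proj₁ i , ∈-map⁺ proj₂ i

  wire-on : ∀ {L x y} → Wire L x y → On L x × On L y
  wire-on (inj₁ h) = half-on h
  wire-on (inj₂ h) = let y , x = half-on h in x , y

  distinct-pair : ∀ {a : E} {bs} → ¬ Unique (a ∷ a ∷ bs)
  distinct-pair ((a≢a ∷ _) ∷ _) = a≢a refl

  module _ {L : Link E} (up : Unique (prems L)) (uc : Unique (concls L)) where

    half-functional : ∀ {x y y′} → Half L x y → Half L x y′ → y ≡ y′
    half-functional tens-l tens-l = refl
    half-functional tens-l tens-r = ⊥-elim (distinct-pair up)
    half-functional tens-r tens-l = ⊥-elim (distinct-pair up)
    half-functional tens-r tens-r = refl
    half-functional par-l par-l = refl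
    half-functional par-l par-r = ⊥-elim (distinct-pair up)
    half-functional par-r par-l = ⊥-elim (distinct-pair up)
    half-functional par-r par-r = refl
    half-functional ax ax = refl
    half-functional cut cut = refl
    half-functional lock lock = refl
    half-functional (sync i) (sync j) = cong (λ c → concl c _) (unique-map-proj₁ up i j)

    half-injective : ∀ {x x′ y} → Half L x y → Half L x′ y → x ≡ x′
    half-injective tens-l tens-l = refl
    half-injective tens-r tens-r = refl
    half-injective par-l par-l = refl
    half-injective par-r par-r = refl
    half-injective ax ax = refl
    half-injective cut cut = refl
    half-injective lock lock = refl
    half-injective (sync i) (sync j) = cong (λ p → prem p _) (unique-map-proj₂ uc i j)

    -- Only at axioms and cuts are both ends of a wire ports of the same kind, and there a chain of
    -- two halves would make the two edges equal.
    half-disjoint : ∀ {x y z} → Half L x y → ¬ Half L y z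
    half-disjoint ax ax = distinct-pair uc
    half-disjoint cut cut = distinct-pair up

    wire-functional : ∀ {x y y′} → Wire L x y → Wire L x y′ → y ≡ y′
    wire-functional (inj₁ h) (inj₁ k) = half-functional h k
    wire-functional (inj₁ h) (inj₂ k) = ⊥-elim (half-disjoint k h)
    wire-functional (inj₂ h) (inj₁ k) = ⊥-elim (half-disjoint h k)
    wire-functional (inj₂ h) (inj₂ k) = half-injective h k

-- Labels

data Label : Set where
  ok up down : Label

label-≟ : DecidableEquality Label
label-≟ ok ok = yes refl
label-≟ ok up = no λ ()
label-≟ ok down = no λ ()
label-≟ up ok = no λ ()
label-≟ up up = yes refl
label-≟ up down = no λ ()
label-≟ down ok = no λ ()
label-≟ down up = no λ ()
label-≟ down down = yes refl

turned : Label → Label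
turned ok = ok
turned up = down
turned down = up

-- `ok` is a unit for both operations; on the other labels `⊗ᴸ` is the maximum and `⅋ᴸ` the minimum
-- for the order `down` < `up`.
_⊗ᴸ_ _⅋ᴸ_ : Label → Label → Label
ok ⊗ᴸ y = y
up ⊗ᴸ _ = up
down ⊗ᴸ up = up
down ⊗ᴸ _ = down
ok ⅋ᴸ y = y
down ⅋ᴸ _ = down
up ⅋ᴸ down = down
up ⅋ᴸ _ = up

-- The Boolean at an address will tell whether the atom there has been visited.
label : Formula → (Addr → Bool) → Label
label One f with f []
... | true = ok
... | false = up
label (X _) f with f []
... | true = ok
... | false = up
label Bot f with f []
... | true = ok
... | false = down
label (X⊥ _) f with f []
... | true = ok
... | false = down
label (A ⊗ B) f = label A (f ∘ (𝐥 ∷_)) ⊗ᴸ label B (f ∘ (𝐫 ∷_))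
label (A ⅋ B) f = label A (f ∘ (𝐥 ∷_)) ⅋ᴸ label B (f ∘ (𝐫 ∷_))

turned-⊗ : ∀ x y → turned (x ⊗ᴸ y) ≡ turned x ⅋ᴸ turned y
turned-⊗ ok y = refl
turned-⊗ up y = refl
turned-⊗ down ok = refl
turned-⊗ down up = refl
turned-⊗ down down = refl

turned-⅋ : ∀ x y → turned (x ⅋ᴸ y) ≡ turned x ⊗ᴸ turned y
turned-⅋ ok y = refl
turned-⅋ down y = refl
turned-⅋ up ok = refl
turned-⅋ up up = refl
turned-⅋ up down = refl

⊗-up : ∀ x y → x ⊗ᴸ y ≡ up → x ≡ up ⊎ y ≡ up
⊗-up ok y eq = inj₂ eq
⊗-up up y eq = inj₁ refl
⊗-up down up eq = inj₂ refl

⊗-down : ∀ x y → x ⊗ᴸ y ≡ down → x ≡ down ⊎ y ≡ down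
⊗-down ok y eq = inj₂ eq
⊗-down down y eq = inj₁ refl

⊗-ok : ∀ x y → x ⊗ᴸ y ≡ ok → x ≡ ok × y ≡ ok
⊗-ok ok ok eq = refl , refl
⊗-ok down ok ()
⊗-ok down up ()
⊗-ok down down ()

-- The two ways on for a walk that comes down into a premiss of a ⊗: further down, or up the other
-- premiss.
⊗-downˡ : ∀ y → down ⊗ᴸ y ≡ down ⊎ y ≡ up
⊗-downˡ ok = inj₁ refl
⊗-downˡ up = inj₂ refl
⊗-downˡ down = inj₁ refl

⊗-downʳ : ∀ x → x ⊗ᴸ down ≡ down ⊎ x ≡ up
⊗-downʳ ok = inj₁ refl
⊗-downʳ up = inj₂ refl
⊗-downʳ down = inj₁ refl

⅋-up : ∀ x y → x ⅋ᴸ y ≡ up → x ≡ up ⊎ y ≡ up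
⅋-up ok y eq = inj₂ eq
⅋-up up y eq = inj₁ refl

⅋-down : ∀ x y → x ⅋ᴸ y ≡ down → x ≡ down ⊎ y ≡ down
⅋-down ok y eq = inj₂ eq
⅋-down down y eq = inj₁ refl
⅋-down up down eq = inj₂ refl

⅋-ok : ∀ x y → x ⅋ᴸ y ≡ ok → x ≡ ok × y ≡ ok
⅋-ok ok ok eq = refl , refl
⅋-ok up ok ()
⅋-ok up up ()
⅋-ok up down ()

-- A walk that comes down into a ⅋ always goes on down; this is half of the reason that it never
-- uses both premisses.
⅋-downʳ : ∀ x → x ⅋ᴸ down ≡ down
⅋-downʳ ok = refl
⅋-downʳ up = refl
⅋-downʳ down = refl

label-cong : ∀ A {f g} → (∀ m → AtomOcc A m → f m ≡ g m) → label A f ≡ label A g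
label-cong One eq rewrite eq [] (inj₁ (One , refl , pa-one)) = refl
label-cong Bot eq rewrite eq [] (inj₂ (Bot , refl , na-bot)) = refl
label-cong (X x) eq rewrite eq [] (inj₁ (X x , refl , pa-X x)) = refl
label-cong (X⊥ x) eq rewrite eq [] (inj₂ (X⊥ x , refl , na-X⊥ x)) = refl
label-cong (A ⊗ B) eq = cong₂ _⊗ᴸ_ (label-cong A (λ m → eq (𝐥 ∷ m))) (label-cong B (λ m → eq (𝐫 ∷ m)))
label-cong (A ⅋ B) eq = cong₂ _⅋ᴸ_ (label-cong A (λ m → eq (𝐥 ∷ m))) (label-cong B (λ m → eq (𝐫 ∷ m)))

-- Negation exchanges polarities and connectives, and so `up` and `down`; hence walks turn round at
-- axioms and cuts.
label-dual : ∀ A f → label (dual A) f ≡ turned (label A f)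
label-dual One f with f []
... | true = refl
... | false = refl
label-dual Bot f with f []
... | true = refl
... | false = refl
label-dual (X x) f with f []
... | true = refl
... | false = refl
label-dual (X⊥ x) f with f []
... | true = refl
... | false = refl
label-dual (A ⊗ B) f = trans (cong₂ _⅋ᴸ_ (label-dual A _) (label-dual B _)) (sym (turned-⊗ (label A _) (label B _)))
label-dual (A ⅋ B) f = trans (cong₂ _⊗ᴸ_ (label-dual A _) (label-dual B _)) (sym (turned-⅋ (label A _) (label B _)))

-- Each connective passes on the label of one of its sides, so `down` can be traced to an unvisited
-- negative atom.
label-¬down : ∀ A {f} → (∀ m → NegOcc A m → f m ≡ true) → label A f ≢ down
label-¬down One {f} _ eq with f []
label-¬down One {f} _ () | true
label-¬down One {f} _ () | false
label-¬down (X x) {f} _ eq with f []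
label-¬down (X x) {f} _ () | true
label-¬down (X x) {f} _ () | false
label-¬down Bot all eq rewrite all [] (Bot , refl , na-bot) with () ← eq
label-¬down (X⊥ x) all eq rewrite all [] (X⊥ x , refl , na-X⊥ x) with () ← eq
label-¬down (A ⊗ B) all eq =
  [ label-¬down A (λ m → all (𝐥 ∷ m)) , label-¬down B (λ m → all (𝐫 ∷ m)) ] (⊗-down (label A _) (label B _) eq)
label-¬down (A ⅋ B) all eq =
  [ label-¬down A (λ m → all (𝐥 ∷ m)) , label-¬down B (λ m → all (𝐫 ∷ m)) ] (⅋-down (label A _) (label B _) eq)

label-¬up : ∀ A {f} → (∀ m → PosOcc A m → f m ≡ true) → label A f ≢ up
label-¬up A {f} all eq =
  label-¬down (dual A) (λ m o → all m (NegOcc-dual⇒PosOcc A m o)) (trans (label-dual A f) (cong turned eq))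

-- Both operations yield `ok` only from two `ok`s, so no unvisited atom is masked by its neighbours.
label-ok : ∀ A {f} m → label A f ≡ ok → AtomOcc A m → f m ≡ true
label-ok One {f} [] eq o with f []
... | true = refl
label-ok Bot {f} [] eq o with f []
... | true = refl
label-ok (X x) {f} [] eq o with f []
... | true = refl
label-ok (X⊥ x) {f} [] eq o with f []
... | true = refl
label-ok (A ⊗ B) (𝐥 ∷ m) eq o = label-ok A m (proj₁ (⊗-ok (label A _) (label B _) eq)) o
label-ok (A ⊗ B) (𝐫 ∷ m) eq o = label-ok B m (proj₂ (⊗-ok (label A _) (label B _) eq)) o
label-ok (A ⅋ B) (𝐥 ∷ m) eq o = label-ok A m (proj₁ (⅋-ok (label A _) (label B _) eq)) o
label-ok (A ⅋ B) (𝐫 ∷ m) eq o = label-ok B m (proj₂ (⅋-ok (label A _) (label B _) eq)) o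
label-ok (A ⊗ B) [] eq (inj₁ (_ , refl , ()))
label-ok (A ⊗ B) [] eq (inj₂ (_ , refl , ()))
label-ok (A ⅋ B) [] eq (inj₁ (_ , refl , ()))
label-ok (A ⅋ B) [] eq (inj₂ (_ , refl , ()))
label-ok One (_ ∷ _) eq (inj₁ (_ , () , _))
label-ok One (_ ∷ _) eq (inj₂ (_ , () , _))
label-ok Bot (_ ∷ _) eq (inj₁ (_ , () , _))
label-ok Bot (_ ∷ _) eq (inj₂ (_ , () , _))
label-ok (X _) (_ ∷ _) eq (inj₁ (_ , () , _))
label-ok (X _) (_ ∷ _) eq (inj₂ (_ , () , _))
label-ok (X⊥ _) (_ ∷ _) eq (inj₁ (_ , () , _))
label-ok (X⊥ _) (_ ∷ _) eq (inj₂ (_ , () , _))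

-- Repetitions in sequences over a finite set

InjectiveBelow : ∀ {n} → (ℕ → Fin n) → ℕ → Set
InjectiveBelow f k = ∀ {x y} → x ℕ.< k → y ℕ.< k → f x ≡ f y → x ≡ y

-- The least index whose value has occurred before has only distinct values ahead of it, and the
-- pigeonhole principle provides a repetition. The segment has `suc len` entries, counted by
-- `x ≤ len` as in `SwitchingCycle`.
firstRepeat : ∀ {n} (f : ℕ → Fin n) → ∃₂ λ i len → f (suc len ℕ.+ i) ≡ f i ×
              (∀ {x y} → x ℕ.≤ len → y ℕ.≤ len → f (x ℕ.+ i) ≡ f (y ℕ.+ i) → x ≡ y)
firstRepeat {n} f with scan (suc n)
  where
  scan : ∀ k → (∃₂ λ i j → i ℕ.< j × f i ≡ f j × InjectiveBelow f j) ⊎ InjectiveBelow f k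
  scan zero = inj₂ λ ()
  scan (suc k) with scan k
  ... | inj₁ found = inj₁ found
  ... | inj₂ inj with ℕ.anyUpTo? (λ i → f i Fin.≟ f k) k
  ... | yes (i , i<k , eq) = inj₁ (i , k , i<k , eq , inj)
  ... | no none = inj₂ inj′
    where
    inj′ : InjectiveBelow f (suc k)
    inj′ {x} {y} (ℕ.s≤s x≤k) (ℕ.s≤s y≤k) eq with ℕ.m≤n⇒m<n∨m≡n x≤k | ℕ.m≤n⇒m<n∨m≡n y≤k
    ... | inj₁ x<k | inj₁ y<k = inj x<k y<k eq
    ... | inj₁ x<k | inj₂ refl = ⊥-elim (none (x , x<k , eq))
    ... | inj₂ refl | inj₁ y<k = ⊥-elim (none (y , y<k , sym eq))
    ... | inj₂ refl | inj₂ refl = refl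
... | inj₂ inj with i , j , i<j , eq ← Fin.pigeonhole (ℕ.n<1+n n) (f ∘ toℕ) =
  ⊥-elim (ℕ.<-irrefl (inj (Fin.toℕ<n i) (Fin.toℕ<n j) eq) i<j)
... | inj₁ (i , j , i<j , eq , inj) with len , refl ← ℕ.m≤n⇒∃[o]m+o≡n i<j =
  i , len , trans (cong (f ∘ suc) (ℕ.+-comm len i)) (sym eq) ,
  λ x≤ y≤ e → ℕ.+-cancelʳ-≡ i _ _ (inj (bound x≤) (bound y≤) e)
  where
  bound : ∀ {x} → x ℕ.≤ len → x ℕ.+ i ℕ.< suc i ℕ.+ len
  bound x≤ = ℕ.s≤s (ℕ.≤-trans (ℕ.+-monoˡ-≤ i x≤) (ℕ.≤-reflexive (ℕ.+-comm len i)))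

-- Token moves as a partial injection on positions

module Machine (R : Net) (isNet : IsSMLLNet R) where
  open Net R
  open IsSMLLNet isNet

  Edge : Set
  Edge = Fin nE

  open DecMembership (Fin._≟_ {nE}) using (_∈?_)

  place : Port Edge → Position R
  place (prem e m) = pos e m
  place (concl e m) = pos e m
  place (box e) = lockPos e 0

  -- Tokens go down on positive atoms and up on negative ones, so they enter a link through positive
  -- premisses and negative conclusions. The unlocked position of a lock can only be arrived at.
  Incoming : Port Edge → Set
  Incoming (prem e m) = PosOcc (ty e) m
  Incoming (concl e m) = NegOcc (ty e) m
  Incoming (box _) = ⊥

  Outgoing : Port Edge → Set
  Outgoing (prem e m) = NegOcc (ty e) m
  Outgoing (concl e m) = PosOcc (ty e) m
  Outgoing (box _) = ⊤

  on-unique : ∀ {l l′} x → On (link l) x → On (link l′) x → l ≡ l′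
  on-unique (prem e _) i j = consumerUnique e _ _ i j
  on-unique (concl e _) i j = producerUnique e _ _ i j
  on-unique (box e) i j = producerUnique e _ _ i j

  -- The polarity of an atom decides which of the two links on its edge a token there heads into, so
  -- the position fixes the port.
  incoming-place : ∀ x x′ → Incoming x → Incoming x′ → place x ≡ place x′ → x ≡ x′
  incoming-place (prem e m) (prem e m) i j refl = refl
  incoming-place (prem e m) (concl e m) i j refl = ⊥-elim (polarity-exclusive (ty e) m i j)
  incoming-place (concl e m) (prem e m) i j refl = ⊥-elim (polarity-exclusive (ty e) m j i)
  incoming-place (concl e m) (concl e m) i j refl = refl

  outgoing-place : ∀ y y′ → Outgoing y → Outgoing y′ → place y ≡ place y′ → y ≡ y′
  outgoing-place (prem e m) (prem e m) i j refl = refl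
  outgoing-place (prem e m) (concl e m) i j refl = ⊥-elim (polarity-exclusive (ty e) m j i)
  outgoing-place (concl e m) (prem e m) i j refl = ⊥-elim (polarity-exclusive (ty e) m i j)
  outgoing-place (concl e m) (concl e m) i j refl = refl
  outgoing-place (box e) (box e) i j refl = refl

  record Transmits (x y : Port Edge) : Set where
    constructor transmits
    field
      in⇒out : Incoming x → Outgoing y
      out⇒in : Outgoing x → Incoming y

  -- Typing gives the atoms joined by a wire the same polarity between a premiss and a conclusion,
  -- and opposite polarities at axioms and cuts; either way a token that comes in at one end goes
  -- out at the other.
  half-transmits : ∀ {L x y} → LinkTyped ty L → Half L x y → Transmits x y × Transmits y x
  half-transmits {x = prem _ m} t tens-l =
    transmits (subst (λ C → PosOcc C (𝐥 ∷ m)) (sym t)) (subst (λ C → NegOcc C (𝐥 ∷ m)) (sym t)) ,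
    transmits (subst (λ C → NegOcc C (𝐥 ∷ m)) t) (subst (λ C → PosOcc C (𝐥 ∷ m)) t)
  half-transmits {x = prem _ m} t tens-r =
    transmits (subst (λ C → PosOcc C (𝐫 ∷ m)) (sym t)) (subst (λ C → NegOcc C (𝐫 ∷ m)) (sym t)) ,
    transmits (subst (λ C → NegOcc C (𝐫 ∷ m)) t) (subst (λ C → PosOcc C (𝐫 ∷ m)) t)
  half-transmits {x = prem _ m} t par-l =
    transmits (subst (λ C → PosOcc C (𝐥 ∷ m)) (sym t)) (subst (λ C → NegOcc C (𝐥 ∷ m)) (sym t)) ,
    transmits (subst (λ C → NegOcc C (𝐥 ∷ m)) t) (subst (λ C → PosOcc C (𝐥 ∷ m)) t)
  half-transmits {x = prem _ m} t par-r =
    transmits (subst (λ C → PosOcc C (𝐫 ∷ m)) (sym t)) (subst (λ C → NegOcc C (𝐫 ∷ m)) (sym t)) ,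
    transmits (subst (λ C → NegOcc C (𝐫 ∷ m)) t) (subst (λ C → PosOcc C (𝐫 ∷ m)) t)
  half-transmits {x = concl a m} t ax =
    transmits (subst (λ C → PosOcc C m) (sym t) ∘ NegOcc⇒PosOcc-dual (ty a) m) (subst (λ C → NegOcc C m) (sym t) ∘ PosOcc⇒NegOcc-dual (ty a) m) ,
    transmits (NegOcc-dual⇒PosOcc (ty a) m ∘ subst (λ C → NegOcc C m) t) (PosOcc-dual⇒NegOcc (ty a) m ∘ subst (λ C → PosOcc C m) t)
  half-transmits {x = prem a m} t cut =
    transmits (subst (λ C → NegOcc C m) (sym t) ∘ PosOcc⇒NegOcc-dual (ty a) m) (subst (λ C → PosOcc C m) (sym t) ∘ NegOcc⇒PosOcc-dual (ty a) m) ,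
    transmits (PosOcc-dual⇒NegOcc (ty a) m ∘ subst (λ C → PosOcc C m) t) (NegOcc-dual⇒PosOcc (ty a) m ∘ subst (λ C → NegOcc C m) t)
  half-transmits t lock =
    transmits (λ _ → tt) (λ o → IsN⇒¬PosOcc [] n-bot (subst (λ C → PosOcc C []) t o)) ,
    transmits ⊥-elim (λ _ → Bot , cong (λ C → sub C []) t , na-bot)
  half-transmits {x = prem _ m} (_ , t) (sync i) with All.lookup t i
  ... | eq , _ =
    transmits (subst (λ C → PosOcc C m) eq) (subst (λ C → NegOcc C m) eq) ,
    transmits (subst (λ C → NegOcc C m) (sym eq)) (subst (λ C → PosOcc C m) (sym eq))

  wire-transmits : ∀ l {x y} → Wire (link l) x y → Transmits x y
  wire-transmits l (inj₁ h) = proj₁ (half-transmits (typed l) h)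
  wire-transmits l (inj₂ h) = proj₂ (half-transmits (typed l) h)

  -- The move of a single token, without regard to locked boxes or to the other tokens of a sync
  -- link. It depends on the net only, so all runs share the same paths.
  record Hop (p p′ : Position R) : Set where
    constructor hop
    field
      via      : Fin nL
      {from to} : Port Edge
      wire     : Wire (link via) from to
      incoming : Incoming from
      source   : p ≡ place from
      target   : p′ ≡ place to

  -- The source fixes the port, the port fixes the link, and the wires of a link form a matching.
  hop-functional : ∀ {p q q′} → Hop p q → Hop p q′ → q ≡ q′
  hop-functional (hop l {x} w i refl refl) (hop l′ {x′} w′ i′ s refl)
    with refl ← incoming-place x x′ i i′ s
    with refl ← on-unique x (proj₁ (wire-on w)) (proj₁ (wire-on w′))
    = cong place (wire-functional (premsUnique l) (conclsUnique l) w w′)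

  hop-injective : ∀ {p p′ q} → Hop p q → Hop p′ q → p ≡ p′
  hop-injective (hop l {x} {y} w i refl refl) (hop l′ {x′} {y′} w′ i′ refl t)
    with refl ← outgoing-place y y′ (Transmits.in⇒out (wire-transmits l w) i) (Transmits.in⇒out (wire-transmits l′ w′) i′) t
    with refl ← on-unique y (proj₂ (wire-on w)) (proj₂ (wire-on w′))
    = cong place (wire-functional (premsUnique l) (conclsUnique l) (swap w) (swap w′))

  position-≟ : DecidableEquality (Position R)
  position-≟ (pos e m) (pos e′ m′) =
    map′ (λ { (refl , refl) → refl }) (λ { refl → refl , refl }) ((e Fin.≟ e′) ×-dec ≡-dec Dir-≟ m m′)
  position-≟ (pos _ _) (lockPos _ _) = no λ ()
  position-≟ (lockPos _ _) (pos _ _) = no λ ()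
  position-≟ (lockPos e i) (lockPos e′ i′) =
    map′ (λ { (refl , refl) → refl }) (λ { refl → refl , refl }) ((e Fin.≟ e′) ×-dec (i ℕ.≟ i′))

  -- `Entry` and `Leave` restate `Incoming` and `Outgoing` at a link for positions instead of ports.
  Entry : Fin nL → Position R → Set
  Entry l (pos e m) = (PosOcc (ty e) m × e ∈ prems (link l)) ⊎ (NegOcc (ty e) m × e ∈ concls (link l))
  Entry l (lockPos _ _) = ⊥

  Leave : Fin nL → Position R → Set
  Leave l (pos e m) = (PosOcc (ty e) m × e ∈ concls (link l)) ⊎ (NegOcc (ty e) m × e ∈ prems (link l))
  Leave l (lockPos e _) = link l ≡ botL e

  entry? : ∀ l p → Dec (Entry l p)
  entry? l (pos e m) = (posOcc? (ty e) m ×-dec (e ∈? prems (link l))) ⊎-dec (negOcc? (ty e) m ×-dec (e ∈? concls (link l)))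
  entry? l (lockPos _ _) = no λ ()

  leave-unique : ∀ q {l l′} → Leave l q → Leave l′ q → l ≡ l′
  leave-unique (pos e m) (inj₁ (_ , i)) (inj₁ (_ , j)) = producerUnique e _ _ i j
  leave-unique (pos e m) (inj₁ (o , _)) (inj₂ (n , _)) = ⊥-elim (polarity-exclusive (ty e) m o n)
  leave-unique (pos e m) (inj₂ (n , _)) (inj₁ (o , _)) = ⊥-elim (polarity-exclusive (ty e) m o n)
  leave-unique (pos e m) (inj₂ (_ , i)) (inj₂ (_ , j)) = consumerUnique e _ _ i j
  leave-unique (lockPos e _) i j = producerUnique e _ _ (onLock i) (onLock j)
    where
    onLock : ∀ {l} → link l ≡ botL e → e ∈ concls (link l)
    onLock eq = subst (λ L → e ∈ concls L) (sym eq) (here refl)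

  incoming-entry : ∀ l x → On (link l) x → Incoming x → Entry l (place x)
  incoming-entry l (prem e m) i o = inj₁ (o , i)
  incoming-entry l (concl e m) i o = inj₂ (o , i)

  entry-port : ∀ l p → Entry l p → Σ (Port Edge) λ x → On (link l) x × Incoming x × p ≡ place x
  entry-port l (pos e m) (inj₁ (o , i)) = prem e m , i , o , refl
  entry-port l (pos e m) (inj₂ (o , i)) = concl e m , i , o , refl

  hop-outgoing : ∀ {p q} (h : Hop p q) → Outgoing (Hop.to h)
  hop-outgoing (hop l w i _ _) = Transmits.in⇒out (wire-transmits l w) i

  hop-entry : ∀ {p q} (h : Hop p q) → Entry (Hop.via h) p
  hop-entry (hop l {x} w i refl refl) = incoming-entry l x (proj₁ (wire-on w)) i

  wire-box : ∀ {L : Link Edge} {x e} → Wire L x (box e) → L ≡ botL e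
  wire-box (inj₁ lock) = refl

  hop-leave : ∀ {p q} (h : Hop p q) → Leave (Hop.via h) q
  hop-leave h@(hop l {to = prem e m} w i refl refl) = inj₂ (hop-outgoing h , proj₂ (wire-on w))
  hop-leave h@(hop l {to = concl e m} w i refl refl) = inj₁ (hop-outgoing h , proj₂ (wire-on w))
  hop-leave (hop l {to = box e} w i refl refl) = wire-box w

  -- Valid positions and starting positions

  data Valid : Position R → Set where
    atom : ∀ {e m} → AtomOcc (ty e) m → Valid (pos e m)
    lock : ∀ {b e} → link b ≡ botL e → Valid (lockPos e 0)

  positions : List (Position R)
  positions = concatMap (λ e → lockPos e 0 ∷ map (pos e) (atoms (ty e))) (allFin nE)

  valid⇒∈positions : ∀ {p} → Valid p → p ∈ positions
  valid⇒∈positions (atom {e} {m} o) = ∈-concatMap⁺ _ (lose (∈-allFin e) (there (∈-map⁺ (pos e) (AtomOcc⇒∈atoms (ty e) m o))))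
  valid⇒∈positions (lock {e = e} _) = ∈-concatMap⁺ _ (lose (∈-allFin e) (here refl))

  hop-valid : ∀ {p q} → Hop p q → Valid q
  hop-valid h@(hop l {to = prem e m} w i refl refl) = atom (inj₂ (hop-outgoing h))
  hop-valid h@(hop l {to = concl e m} w i refl refl) = atom (inj₁ (hop-outgoing h))
  hop-valid h@(hop l {to = box e} w i refl refl) = lock (wire-box w)

  Start : Position R → Set
  Start p = INIT R p ⊎ ONES R p

  start-valid : ∀ {p} → Start p → Valid p
  start-valid (inj₁ (e , m , refl , _ , o)) = atom (inj₂ o)
  start-valid (inj₂ (o , e , eq , refl)) =
    atom (inj₁ (One , cong (λ A → sub A []) (subst (LinkTyped ty) eq (typed o)) , pa-one))

  -- A hop to a negative atom leaves its link upwards through a premiss, but a conclusion of the net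
  -- is no premiss. A hop to the positive atom of a one link would leave that link, which has no
  -- wires.
  start-no-hop : ∀ {p q} → Start q → ¬ Hop p q
  start-no-hop (inj₁ (e , m , refl , isC , neg)) h with hop-leave h
  ... | inj₁ (o , _) = polarity-exclusive (ty e) m o neg
  ... | inj₂ (_ , i) = isC _ i
  start-no-hop (inj₂ (o , e , eq , refl)) h with hop-leave h
  ... | inj₂ (n , _) = IsP⇒¬NegOcc [] p-one (subst (λ A → NegOcc A []) (subst (LinkTyped ty) eq (typed o)) n)
  ... | inj₁ (_ , i) with producerUnique e _ _ i (subst (λ L → e ∈ concls L) (sym eq) (here refl))
  ... | refl = [ (λ ()) , (λ ()) ] (subst (λ L → Wire L (Hop.from h) (Hop.to h)) eq (Hop.wire h))

  -- No link traps a token: every incoming atom has an address at which the link has a wire, and the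
  -- conclusion of a one link has no negative atom.
  outlet : ∀ {L} x → LinkTyped ty L → On L x → Incoming x → Σ (Port Edge) (Wire L x)
  outlet {cutL a b} (prem _ m) t (here refl) o = _ , inj₁ cut
  outlet {cutL a b} (prem _ m) t (there (here refl)) o = _ , inj₂ cut
  outlet {tensL a b c} (prem _ m) t (here refl) o = _ , inj₁ tens-l
  outlet {tensL a b c} (prem _ m) t (there (here refl)) o = _ , inj₁ tens-r
  outlet {parL a b c} (prem _ m) t (here refl) o = _ , inj₁ par-l
  outlet {parL a b c} (prem _ m) t (there (here refl)) o = _ , inj₁ par-r
  outlet {syncL ps} (prem _ m) t i o with _ , j , refl ← ∈-map⁻ proj₁ i = _ , inj₁ (sync j)
  outlet {axL a b} (concl _ m) t (here refl) o = _ , inj₁ ax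
  outlet {axL a b} (concl _ m) t (there (here refl)) o = _ , inj₂ ax
  outlet {tensL a b c} (concl _ []) t (here refl) o
    with _ , refl , () ← subst (λ C → NegOcc C []) t o
  outlet {tensL a b c} (concl _ (𝐥 ∷ m)) t (here refl) o = _ , inj₂ tens-l
  outlet {tensL a b c} (concl _ (𝐫 ∷ m)) t (here refl) o = _ , inj₂ tens-r
  outlet {parL a b c} (concl _ []) t (here refl) o
    with _ , refl , () ← subst (λ C → NegOcc C []) t o
  outlet {parL a b c} (concl _ (𝐥 ∷ m)) t (here refl) o = _ , inj₂ par-l
  outlet {parL a b c} (concl _ (𝐫 ∷ m)) t (here refl) o = _ , inj₂ par-r
  outlet {oneL e} (concl _ m) t (here refl) o = ⊥-elim (IsP⇒¬NegOcc m p-one (subst (λ C → NegOcc C m) t o))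
  outlet {botL e} (concl _ []) t (here refl) o = _ , inj₁ lock
  outlet {botL e} (concl _ (_ ∷ m)) t (here refl) o
    with _ , () , _ ← subst (λ C → NegOcc C (_ ∷ m)) t o
  outlet {syncL ps} (concl _ m) t i o with _ , j , refl ← ∈-map⁻ proj₂ i = _ , inj₂ (sync j)

  entry-hop : ∀ l p → Entry l p → ∃ λ q → Σ (Hop p q) λ h → Hop.via h ≡ l
  entry-hop l p i with entry-port l p i
  ... | x , on , inc , eq with outlet x (typed l) on inc
  ... | y , w = place y , hop l w inc eq refl , refl

  -- Moves of the machine as hops

  wire-hop : ∀ {l L x y} → link l ≡ L → Wire L x y → Incoming x → Σ (Hop (place x) (place y)) λ h → Hop.via h ≡ l
  wire-hop {l} {x = x} {y} eq w i = hop l (subst (λ L → Wire L x y) (sym eq) w) i refl refl , refl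

  through-hop : ∀ {l p q} → Through R l p q → Σ (Hop p q) λ h → Hop.via h ≡ l
  through-hop (tens-down-l eq o) = wire-hop eq (inj₁ tens-l) o
  through-hop (tens-down-r eq o) = wire-hop eq (inj₁ tens-r) o
  through-hop (par-down-l eq o) = wire-hop eq (inj₁ par-l) o
  through-hop (par-down-r eq o) = wire-hop eq (inj₁ par-r) o
  through-hop (tens-up-l eq o) = wire-hop eq (inj₂ tens-l) o
  through-hop (tens-up-r eq o) = wire-hop eq (inj₂ tens-r) o
  through-hop (par-up-l eq o) = wire-hop eq (inj₂ par-l) o
  through-hop (par-up-r eq o) = wire-hop eq (inj₂ par-r) o
  through-hop (cut-l eq o) = wire-hop eq (inj₁ cut) o
  through-hop (cut-r eq o) = wire-hop eq (inj₂ cut) o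
  through-hop (ax-l eq o) = wire-hop eq (inj₁ ax) o
  through-hop (ax-r eq o) = wire-hop eq (inj₂ ax) o
  through-hop {l} (lock eq) =
    wire-hop eq (inj₁ lock) (Bot , cong (λ A → sub A []) (subst (LinkTyped ty) eq (typed l)) , na-bot)

  through-¬sync : ∀ {l p q} → Through R l p q → ¬ IsSync (link l)
  through-¬sync (tens-down-l eq _) = (λ ()) ∘ subst IsSync eq
  through-¬sync (tens-down-r eq _) = (λ ()) ∘ subst IsSync eq
  through-¬sync (par-down-l eq _) = (λ ()) ∘ subst IsSync eq
  through-¬sync (par-down-r eq _) = (λ ()) ∘ subst IsSync eq
  through-¬sync (tens-up-l eq _) = (λ ()) ∘ subst IsSync eq
  through-¬sync (tens-up-r eq _) = (λ ()) ∘ subst IsSync eq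
  through-¬sync (par-up-l eq _) = (λ ()) ∘ subst IsSync eq
  through-¬sync (par-up-r eq _) = (λ ()) ∘ subst IsSync eq
  through-¬sync (cut-l eq _) = (λ ()) ∘ subst IsSync eq
  through-¬sync (cut-r eq _) = (λ ()) ∘ subst IsSync eq
  through-¬sync (ax-l eq _) = (λ ()) ∘ subst IsSync eq
  through-¬sync (ax-r eq _) = (λ ()) ∘ subst IsSync eq
  through-¬sync (lock eq) = (λ ()) ∘ subst IsSync eq

  wire-through : ∀ {l L x y} → link l ≡ L → Wire L x y → ¬ IsSync L → Incoming x → Through R l (place x) (place y)
  wire-through eq (inj₁ tens-l) _ o = tens-down-l eq o
  wire-through eq (inj₁ tens-r) _ o = tens-down-r eq o
  wire-through eq (inj₁ par-l) _ o = par-down-l eq o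
  wire-through eq (inj₁ par-r) _ o = par-down-r eq o
  wire-through eq (inj₁ ax) _ o = ax-l eq o
  wire-through eq (inj₁ cut) _ o = cut-l eq o
  wire-through eq (inj₁ lock) _ o = lock eq
  wire-through eq (inj₁ (sync _)) ns o = ⊥-elim (ns isSync)
  wire-through eq (inj₂ tens-l) _ o = tens-up-l eq o
  wire-through eq (inj₂ tens-r) _ o = tens-up-r eq o
  wire-through eq (inj₂ par-l) _ o = par-up-l eq o
  wire-through eq (inj₂ par-r) _ o = par-up-r eq o
  wire-through eq (inj₂ ax) _ o = ax-r eq o
  wire-through eq (inj₂ cut) _ o = cut-r eq o
  wire-through eq (inj₂ (sync _)) ns o = ⊥-elim (ns isSync)

  -- With `through-hop` and `through-¬sync`: the moves of single tokens are exactly the hops through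
  -- links other than sync links.
  hop-through : ∀ {p q} (h : Hop p q) → ¬ IsSync (link (Hop.via h)) → Through R (Hop.via h) p q
  hop-through (hop l w i refl refl) ns = wire-through refl w ns i

  through? : ∀ l p → Dec (∃ (Through R l p))
  through? l p with isSync? (link l) | entry? l p
  ... | yes s | _ = no λ (_ , t) → through-¬sync t s
  ... | no ns | no ¬i = no λ (_ , t) → let h , eq = through-hop t in ¬i (subst (λ k → Entry k p) eq (hop-entry h))
  ... | no ns | yes i with q , h , refl ← entry-hop l p i = yes (q , hop-through h ns)

  -- Synchronisation links

  -- Positive formulas have only positive atoms and negative formulas only negative ones, so every
  -- atom of an in-edge heads into the link; `entry-inout` is the converse.
  inout-hop : ∀ {s ps pc i o} m → link s ≡ syncL ps → pc ∈ ps → InOut R pc i o → AtomOcc (ty i) m →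
              Σ (Hop (pos i m) (pos o m)) λ h → Hop.via h ≡ s
  inout-hop {s} {pc = p , c} m eq j (inj₁ (P , refl , refl)) (inj₁ a) =
    hop s (inj₁ (subst (λ L → Half L (prem p m) (concl c m)) (sym eq) (sync j))) a refl refl , refl
  inout-hop m eq j (inj₁ (P , refl , refl)) (inj₂ a) = ⊥-elim (IsP⇒¬NegOcc m P a)
  inout-hop {s} {pc = p , c} m eq j (inj₂ (N , refl , refl)) (inj₁ a) with subst (LinkTyped ty) eq (typed s)
  ... | _ , t = ⊥-elim (IsN⇒¬PosOcc m N (subst (λ A → PosOcc A m) (sym (proj₁ (All.lookup t j))) a))
  inout-hop {s} {pc = p , c} m eq j (inj₂ (N , refl , refl)) (inj₂ a) =
    hop s (inj₂ (subst (λ L → Half L (prem p m) (concl c m)) (sym eq) (sync j))) a refl refl , refl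

  entry-inout : ∀ {s ps} q → link s ≡ syncL ps → Entry s q →
                Σ (Edge × Edge) λ pc → pc ∈ ps × Σ Edge λ i → Σ Edge λ o → InOut R pc i o × Σ Addr λ m → AtomOcc (ty i) m × q ≡ pos i m
  entry-inout {s} (pos e m) eq (inj₁ (a , j)) with ∈-map⁻ proj₁ (subst (λ L → e ∈ prems L) eq j) | subst (LinkTyped ty) eq (typed s)
  ... | (_ , c) , k , refl | _ , t with proj₂ (All.lookup t k)
  ... | inj₁ P = (e , c) , k , e , c , inj₁ (P , refl , refl) , m , inj₁ a , refl
  ... | inj₂ N = ⊥-elim (IsN⇒¬PosOcc m N a)
  entry-inout {s} (pos e m) eq (inj₂ (a , j)) with ∈-map⁻ proj₂ (subst (λ L → e ∈ concls L) eq j) | subst (LinkTyped ty) eq (typed s)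
  ... | (p , _) , k , refl | _ , t with All.lookup t k
  ... | eq′ , inj₁ P = ⊥-elim (IsP⇒¬NegOcc m P (subst (λ A → NegOcc A m) (sym eq′) a))
  ... | _ , inj₂ N = (p , e) , k , e , p , inj₂ (N , refl , refl) , m , inj₂ a , refl

  -- All outgoing atoms of a sync link are wired to incoming ones, so none of them is a starting
  -- position.
  leave-hop : ∀ {s ps} q → link s ≡ syncL ps → Leave s q → ∃ λ p → Σ (Hop p q) λ h → Hop.via h ≡ s
  leave-hop {s} (pos e m) eq (inj₁ (a , i)) with (p , _) , j , refl ← ∈-map⁻ proj₂ (subst (λ L → e ∈ concls L) eq i) =
    let w = subst (λ L → Half L (prem p m) (concl e m)) (sym eq) (sync j) in
    pos p m , hop s (inj₁ w) (Transmits.out⇒in (wire-transmits s (inj₂ w)) a) refl refl , refl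
  leave-hop {s} (pos e m) eq (inj₂ (a , i)) with (_ , c) , j , refl ← ∈-map⁻ proj₁ (subst (λ L → e ∈ prems L) eq i) =
    let w = subst (λ L → Half L (prem e m) (concl c m)) (sym eq) (sync j) in
    pos c m , hop s (inj₂ w) (Transmits.out⇒in (wire-transmits s (inj₁ w)) a) refl refl , refl
  leave-hop (lockPos _ _) eq i with () ← trans (sym eq) i

  -- Boxes

  inside-trans : ∀ {a b c} → Inside R a b → Inside R b c → Inside R a c
  inside-trans (here eq) j = there eq j
  inside-trans (there eq i) j = there eq (inside-trans i j)

  -- A strict partial order on a finite set is well founded in both directions: `inside-wellFounded`
  -- recurses into the contents of boxes, `inside-noetherian` towards depth 0.
  inside-isStrictPartialOrder : IsStrictPartialOrder _≡_ (Inside R)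
  inside-isStrictPartialOrder = record
    { isEquivalence = isEquivalence
    ; irrefl = λ { refl → nestingAcyclic _ }
    ; trans = inside-trans
    ; <-resp-≈ = (λ { refl i → i }) , (λ { refl i → i })
    }

  inside-wellFounded : WellFounded (Inside R)
  inside-wellFounded = spo-wellFounded inside-isStrictPartialOrder

  inside-noetherian : WellFounded (flip (Inside R))
  inside-noetherian = spo-noetherian inside-isStrictPartialOrder

  inside-depth0 : ∀ {l b} → parent l ≡ nothing → ¬ Inside R l b
  inside-depth0 eq (here eq′) with () ← trans (sym eq) eq′
  inside-depth0 eq (there eq′ _) with () ← trans (sym eq) eq′

  inside-step : ∀ {l c b} → parent l ≡ just c → Inside R l b → b ≡ c ⊎ Inside R c b
  inside-step eq (here eq′) = inj₁ (just-injective (trans (sym eq′) eq))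
  inside-step eq (there eq′ i) with just-injective (trans (sym eq) eq′)
  ... | refl = inj₂ i

  inside? : ∀ l b → Dec (Inside R l b)
  inside? l b = go l (inside-noetherian l)
    where
    go : ∀ l → Acc (flip (Inside R)) l → Dec (Inside R l b)
    go l (acc rec) with parent l in eq
    ... | nothing = no (inside-depth0 eq)
    ... | just c with b Fin.≟ c
    ... | yes refl = yes (here eq)
    ... | no b≢c = map′ (there eq) (λ i → [ ⊥-elim ∘ b≢c , (λ j → j) ] (inside-step eq i)) (go c (rec (here eq)))

  -- Tokens can enter the level: its box and all boxes around it are unlocked. This is `BoxesOpen`
  -- stated for the level at which a link lies.
  OpenLevel : State R → Maybe (Fin nL) → Set
  OpenLevel T nothing = ⊤
  OpenLevel T (just b) = Unlocked R T b × BoxesOpen R T b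

  openLevel⇒boxesOpen : ∀ {T} l → OpenLevel T (parent l) → BoxesOpen R T l
  openLevel⇒boxesOpen l o b i with parent l in eq
  ... | nothing = ⊥-elim (inside-depth0 eq i)
  ... | just c with inside-step eq i
  ... | inj₁ refl = proj₁ o
  ... | inj₂ j = proj₂ o b j

  boxesOpen⇒openLevel : ∀ {T} l → BoxesOpen R T l → OpenLevel T (parent l)
  boxesOpen⇒openLevel l o with parent l in eq
  ... | nothing = tt
  ... | just c = o c (here eq) , λ b i → o b (there eq i)

  -- Decidable properties of states

  Supported : State R → Set
  Supported T = ∀ {n p} → T n ≡ just p → Valid n

  Occupied : State R → Position R → Set
  Occupied T q = ∃ λ n → T n ≡ just q

  module _ {T : State R} (supp : Supported T) where

    -- There are infinitely many possible names, but those in use are valid positions, so a search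
    -- of the finite list `positions` suffices.
    anyToken? : ∀ {Q : Position R → Position R → Set} → (∀ n p → Dec (Q n p)) → Dec (∃ λ n → ∃ λ p → T n ≡ just p × Q n p)
    anyToken? {Q} Q? = map′ (λ a → let n , _ , x = find a in n , x) (λ (n , p , eq , x) → lose (valid⇒∈positions (supp eq)) (p , eq , x))
                        (Any.any? at? positions)
      where
      at? : ∀ n → Dec (∃ λ p → T n ≡ just p × Q n p)
      at? n with T n
      ... | nothing = no λ ()
      ... | just p = map′ (λ x → p , refl , x) (λ { (_ , refl , x) → x }) (Q? n p)

    occupied? : ∀ q → Dec (Occupied T q)
    occupied? q = map′ (λ { (n , _ , eq , refl) → n , eq }) (λ (n , eq) → n , q , eq , refl)
                    (anyToken? λ _ p → position-≟ p q)

    unlocked? : ∀ b → Dec (Unlocked R T b)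
    unlocked? b with link b in eq
    ... | axL _ _ = no λ { (_ , () , _) }
    ... | cutL _ _ = no λ { (_ , () , _) }
    ... | tensL _ _ _ = no λ { (_ , () , _) }
    ... | parL _ _ _ = no λ { (_ , () , _) }
    ... | oneL _ = no λ { (_ , () , _) }
    ... | syncL _ = no λ { (_ , () , _) }
    ... | botL e = map′ (λ { (n , p , eq , i , refl) → e , refl , n , i , eq }) (λ { (_ , refl , n , i , eq) → n , _ , eq , i , refl })
                     (anyToken? λ _ → onLock?)
      where
      onLock? : ∀ p → Dec (∃ λ i → p ≡ lockPos e i)
      onLock? (pos _ _) = no λ ()
      onLock? (lockPos e′ i) = map′ (λ { refl → i , refl }) (λ { (_ , refl) → refl }) (e′ Fin.≟ e)

    boxesOpen? : ∀ l → Dec (BoxesOpen R T l)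
    boxesOpen? l = Fin.all? λ b → inside? l b →-dec unlocked? b

  -- Enabled transitions

  -- The part of `Step` that concerns the source state only; it mentions no target function and is
  -- decided by finite search.
  data Enabled (T : State R) : Set where
    moves   : ∀ l n {p q} → T n ≡ just p → Through R l p q → BoxesOpen R T l → Enabled T
    syncs   : ∀ s → IsSync (link s) → BoxesOpen R T s → (∀ q → Entry s q → Occupied T q) → Enabled T
    creates : ∀ o {e} → link o ≡ oneL e → T (pos e []) ≡ nothing → BoxesOpen R T o → Enabled T

  step⇒enabled : ∀ {T T′} → Step R T T′ → Enabled T
  step⇒enabled (move l n p p′ at t open′ _ _) = moves l n at t open′
  step⇒enabled (sync s ps eq open′ full _) = syncs s (subst IsSync (sym eq) isSync) open′ occ
    where
    occ : ∀ q → Entry s q → Occupied _ q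
    occ q i with pc , j , i , o , io , m , a , refl ← entry-inout q eq i = full pc j i o io m a
  step⇒enabled (create o e eq none open′ _ _) = creates o eq none open′

  update : State R → Position R → Position R → State R
  update T n p n′ with position-≟ n′ n
  ... | yes _ = just p
  ... | no _ = T n′

  update-at : ∀ T n p → update T n p n ≡ just p
  update-at T n p with position-≟ n n
  ... | yes _ = refl
  ... | no n≢n = ⊥-elim (n≢n refl)

  update-other : ∀ T n p n′ → n′ ≢ n → update T n p n′ ≡ T n′
  update-other T n p n′ n′≢n with position-≟ n′ n
  ... | yes eq = ⊥-elim (n′≢n eq)
  ... | no _ = refl

  module _ (T : State R) (s : Fin nL) {ps} (eq : link s ≡ syncL ps) (valid : ∀ {n p} → T n ≡ just p → Valid p) where

    fire : State R
    fire n with T n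
    ... | nothing = nothing
    ... | just q with entry? s q
    ... | no _ = just q
    ... | yes i with _ , _ , _ , o , _ , m , _ ← entry-inout q eq i = just (pos o m)

    fire-spec : ∀ n → (Σ (Edge × Edge) λ pc → pc ∈ ps × Σ Edge λ i → Σ Edge λ o →
                       InOut R pc i o × Σ Addr λ m → T n ≡ just (pos i m) × fire n ≡ just (pos o m))
                    ⊎ ((∀ q → T n ≡ just q → ¬ OnInEdge R ps q) × fire n ≡ T n)
    fire-spec n with T n in at
    ... | nothing = inj₂ ((λ _ ()) , refl)
    ... | just q with entry? s q
    ... | yes i with pc , j , i , o , io , m , _ , refl ← entry-inout q eq i = inj₁ (pc , j , i , o , io , m , refl , refl)
    ... | no ¬i = inj₂ ((λ { q refl → notIn q at ¬i }) , refl)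
      where
      -- `OnInEdge` allows any address on an in-edge; validity of the token's position supplies the
      -- atom occurrence that `Entry` asks for.
      notIn : ∀ q → T n ≡ just q → ¬ Entry s q → ¬ OnInEdge R ps q
      notIn _ at ¬i (pc , j , i , o , io , m , refl) with valid at
      ... | atom a with h , refl ← inout-hop m eq j io a = ¬i (hop-entry h)

  enabled⇒step : ∀ {T} → (∀ {n p} → T n ≡ just p → Valid p) → Enabled T → ∃ (Step R T)
  enabled⇒step {T} v (moves l n {p} {q} at t open′) =
    update T n q , move l n p q at t open′ (update-at T n q) (update-other T n q)
  enabled⇒step {T} v (creates o {e} eq none open′) =
    update T (pos e []) (pos e []) , create o e eq none open′ (update-at T (pos e []) (pos e [])) (update-other T (pos e []) (pos e []))
  enabled⇒step {T} v (syncs s sy open′ full) with link s in eq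
  enabled⇒step {T} v (syncs s isSync open′ full) | syncL ps =
    fire T s eq v , sync s ps eq open′ (λ pc j i o io m a → let h , via = inout-hop m eq j io a in full (pos i m) (subst (λ k → Entry k (pos i m)) via (hop-entry h))) (fire-spec T s eq v)

  enabled? : ∀ {T} → Supported T → Dec (Enabled T)
  enabled? {T} supp = map′
    [ (λ (l , (n , p , at , _ , t) , open′) → moves l n at t open′)
    , [ (λ (s , sy , open′ , full) → syncs s sy open′ (λ q i → All.lookup full (valid⇒∈positions (entry-valid i)) i))
      , (λ (o , e , eq , none , open′) → creates o eq none open′) ] ]
    (λ { (moves l n at t open′) → inj₁ (l , (n , _ , at , _ , t) , open′)
       ; (syncs s sy open′ full) → inj₂ (inj₁ (s , sy , open′ , All.tabulate (λ {q} _ → full q)))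
       ; (creates o eq none open′) → inj₂ (inj₂ (o , _ , eq , none , open′)) })
    (Fin.any? (λ l → anyToken? supp (λ _ p → through? l p) ×-dec boxesOpen? supp l)
     ⊎-dec (Fin.any? (λ s → isSync? (link s) ×-dec boxesOpen? supp s ×-dec All.all? (λ q → entry? s q →-dec occupied? supp q) positions)
     ⊎-dec Fin.any? (λ o → Fin.any? λ e → isOne? (link o) e ×-dec none? (T (pos e [])) ×-dec boxesOpen? supp o)))
    where
    entry-valid : ∀ {s q} → Entry s q → Valid q
    entry-valid {q = pos e m} (inj₁ (a , _)) = atom (inj₁ a)
    entry-valid {q = pos e m} (inj₂ (a , _)) = atom (inj₂ a)
    isOne? : ∀ L e → Dec (L ≡ oneL e)
    isOne? (oneL e′) e = map′ (cong oneL) (λ { refl → refl }) (e′ Fin.≟ e)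
    isOne? (axL _ _) e = no λ ()
    isOne? (cutL _ _) e = no λ ()
    isOne? (tensL _ _ _) e = no λ ()
    isOne? (parL _ _ _) e = no λ ()
    isOne? (botL _) e = no λ ()
    isOne? (syncL _) e = no λ ()
    none? : ∀ (t : Maybe (Position R)) → Dec (t ≡ nothing)
    none? nothing = yes refl
    none? (just _) = no λ ()

  -- The invariant of runs

  leave-¬start : ∀ {s} q → IsSync (link s) → Leave s q → ¬ Start q
  leave-¬start {s} q sy lv st with link s in eq
  leave-¬start {s} q isSync lv st | syncL _ = start-no-hop st (proj₁ (proj₂ (leave-hop q eq lv)))

  -- Tokens leave a sync link together: if `q` has just been reached through one, all its outgoing
  -- positions are occupied.
  Synced : State R → Position R → Set
  Synced T q = ∀ {s q′} → IsSync (link s) → Leave s q → Leave s q′ → Occupied T q′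

  data Changed (T T′ : State R) (n : Position R) : Position R → Set where
    moved   : ∀ {p q} → T n ≡ just p → Hop p q → T′ n ≡ just q → Synced T′ q → Changed T T′ n q
    created : ONES R n → T n ≡ nothing → T′ n ≡ just n → Changed T T′ n n

  -- A common form of the three kinds of transition: each token stays, hops once or is created, and
  -- at least one does not stay.
  record Advance (T T′ : State R) : Set where
    field
      change   : ∀ n → T′ n ≡ T n ⊎ ∃ (Changed T T′ n)
      progress : ∃₂ (Changed T T′)

  through-synced : ∀ {T l p q} → Through R l p q → Synced T q
  through-synced {q = q} t sy lv _ with h , refl ← through-hop t with refl ← leave-unique q lv (hop-leave h) =
    ⊥-elim (through-¬sync t sy)

  module _ {T T′ : State R} (s : Fin nL) {ps} (eq : link s ≡ syncL ps)
           (full : ∀ pc → pc ∈ ps → ∀ i o → InOut R pc i o → ∀ m → AtomOcc (ty i) m → Occupied T (pos i m))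
           (change : ∀ n → (Σ (Edge × Edge) λ pc → pc ∈ ps × Σ Edge λ i → Σ Edge λ o →
                             InOut R pc i o × Σ Addr λ m → T n ≡ just (pos i m) × T′ n ≡ just (pos o m))
                         ⊎ ((∀ q → T n ≡ just q → ¬ OnInEdge R ps q) × T′ n ≡ T n)) where

    sync-moves : ∀ {p} → Entry s p → ∃₂ λ n q → T n ≡ just p × T′ n ≡ just q × Σ (Hop p q) λ h → Hop.via h ≡ s
    sync-moves {p} en with pc , j , i , o , io , m , a , refl ← entry-inout p eq en
                      with n , at ← full pc j i o io m a
                      with change n
    ... | inj₂ (away , _) = ⊥-elim (away _ at (pc , j , i , o , io , m , refl))
    ... | inj₁ (_ , j′ , _ , _ , io′ , _ , at′ , to) with refl ← just-injective (trans (sym at) at′) =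
      n , _ , at , to , inout-hop m eq j′ io′ a

    sync-synced : ∀ {p q} (h : Hop p q) → Hop.via h ≡ s → Synced T′ q
    sync-synced {q = q} h refl {q′ = q′} sy lv lv′ with refl ← leave-unique q lv (hop-leave h)
                                                  with p′ , h′ , refl ← leave-hop q′ eq lv′
                                                  with n , q″ , _ , to , h″ , _ ← sync-moves (hop-entry h′)
                                                  with refl ← hop-functional h′ h″ = n , to

  step⇒advance : ∀ {T T′} → (∀ {n p} → T n ≡ just p → Valid p) → Step R T T′ → Advance T T′
  step⇒advance {T} {T′} v (move l n p p′ at t _ to others) = record { change = change ; progress = n , p′ , new }
    where
    new = moved at (proj₁ (through-hop t)) to (through-synced t)
    change : ∀ n → T′ n ≡ T n ⊎ ∃ (Changed T T′ n)
    change n′ with position-≟ n′ n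
    ... | yes refl = inj₂ (p′ , new)
    ... | no n′≢n = inj₁ (others n′ n′≢n)
  step⇒advance {T} {T′} v (create o e eq none _ to others) = record { change = change ; progress = pos e [] , pos e [] , new }
    where
    new = created (o , e , eq , refl) none to
    change : ∀ n → T′ n ≡ T n ⊎ ∃ (Changed T T′ n)
    change n′ with position-≟ n′ (pos e [])
    ... | yes refl = inj₂ (pos e [] , new)
    ... | no n′≢n = inj₁ (others n′ n′≢n)
  step⇒advance {T} {T′} v (sync s ps eq _ full act) = record { change = change ; progress = progress }
    where
    change : ∀ n → T′ n ≡ T n ⊎ ∃ (Changed T T′ n)
    change n with act n
    ... | inj₂ (_ , eq′) = inj₁ eq′
    ... | inj₁ (pc , j , i , o , io , m , at , to) with atom a ← v at with h , via ← inout-hop m eq j io a =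
      inj₂ (_ , moved at h to (sync-synced s eq full act h via))
    -- A sync link has at least one pair and every formula has an atom, so some token does cross.
    first : NonEmpty ps → All (λ pc → ty (proj₁ pc) ≡ ty (proj₂ pc) × (IsP (ty (proj₁ pc)) ⊎ IsN (ty (proj₁ pc)))) ps → ∃ (Entry s)
    first (nonEmpty (p , c) _) ((_ , inj₁ P) ∷ _) with m , a ← someAtom (ty p)
      with h , refl ← inout-hop m eq (here refl) (inj₁ (P , refl , refl)) a = pos p m , hop-entry h
    first (nonEmpty (p , c) _) ((_ , inj₂ N) ∷ _) with m , a ← someAtom (ty c)
      with h , refl ← inout-hop m eq (here refl) (inj₂ (N , refl , refl)) a = pos c m , hop-entry h
    progress : ∃₂ (Changed T T′)
    progress with nonempty , t ← subst (LinkTyped ty) eq (typed s)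
             with _ , en ← first nonempty t
             with n , q , at , to , h , via ← sync-moves s eq full act en =
      n , q , moved at h to (sync-synced s eq full act h via)

  -- States keep no history, so `Visited` stands for the positions occupied so far. The length of
  -- `pending`, which covers the valid positions not yet visited, is the termination measure. By
  -- `fresh` no token is about to return to a visited position; by `synced` the outgoing positions
  -- of a sync link are visited all or none.
  record Invariant (T : State R) : Set₁ where
    field
      Visited  : Position R → Set
      visited? : ∀ q → Dec (Visited q)
      pending  : List (Position R)
      covers   : ∀ {q} → Valid q → ¬ Visited q → q ∈ pending
      current  : ∀ {n p} → T n ≡ just p → Visited p
      reached  : ∀ {n p} → T n ≡ just p → Start n × Star Hop n p
      forward  : ∀ {q} → Visited q → Occupied T q ⊎ ∃ λ q′ → Hop q q′ × Visited q′
      backward : ∀ {q} → Visited q → Start q ⊎ ∃ λ p → Hop p q × Visited p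
      born     : ∀ {q} → Visited q → Start q → T q ≢ nothing
      initial  : ∀ {q} → INIT R q → Visited q
      fresh    : ∀ {n p q} → T n ≡ just p → Hop p q → ¬ Visited q
      apart    : ∀ {n n′ p} → T n ≡ just p → T n′ ≡ just p → n ≡ n′
      synced   : ∀ {s q q′} → IsSync (link s) → Leave s q → Leave s q′ → Visited q → Visited q′

    -- A starting position has no predecessor, and any other position has only one because hops are
    -- injective.
    visited-backward : ∀ {p q} → Hop p q → Visited q → Visited p
    visited-backward h v with backward v
    ... | inj₁ st = ⊥-elim (start-no-hop st h)
    ... | inj₂ (_ , h′ , v′) with refl ← hop-injective h h′ = v′

    visited-valid : ∀ {q} → Visited q → Valid q
    visited-valid v with backward v
    ... | inj₁ st = start-valid st
    ... | inj₂ (_ , h , _) = hop-valid h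

    current-valid : ∀ {n p} → T n ≡ just p → Valid p
    current-valid at = visited-valid (current at)

    supported : Supported T
    supported at = start-valid (proj₁ (reached at))

  -- Preservation of the invariant and decrease of the measure

  module _ {T T′ : State R} (I : Invariant T) (A : Advance T T′) where
    open Invariant I
    open Advance A

    Visited′ : Position R → Set
    Visited′ q = Visited q ⊎ Occupied T′ q

    changed-fresh : ∀ {n q} → Changed T T′ n q → ¬ Visited q
    changed-fresh (moved at h _ _) = fresh at h
    changed-fresh (created one none _) v = born v (inj₂ one) none

    changed-to : ∀ {n q} → Changed T T′ n q → T′ n ≡ just q
    changed-to (moved _ _ to _) = to
    changed-to (created _ _ to) = to

    data Origin (n p : Position R) : Set where
      stayed : T n ≡ just p → Origin n p
      new    : Changed T T′ n p → Origin n p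

    origin : ∀ {n p} → T′ n ≡ just p → Origin n p
    origin {n} to with change n
    ... | inj₁ same = stayed (trans (sym same) to)
    ... | inj₂ (q , c) with refl ← just-injective (trans (sym to) (changed-to c)) = new c

    reached′ : ∀ {n p} → T′ n ≡ just p → Start n × Star Hop n p
    reached′ to with origin to
    ... | stayed at = reached at
    ... | new (moved at h _ _) = let st , r = reached at in st , r ◅◅ h ◅ ε
    ... | new (created one _ _) = inj₂ one , ε

    visited′? : ∀ q → Dec (Visited′ q)
    visited′? q = visited? q ⊎-dec occupied? (λ to → start-valid (proj₁ (reached′ to))) q

    unvisited? : ∀ q → Dec (¬ Visited′ q)
    unvisited? q = ¬? (visited′? q)

    forward′ : ∀ {q} → Visited′ q → Occupied T′ q ⊎ ∃ λ q′ → Hop q q′ × Visited′ q′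
    forward′ (inj₂ o) = inj₁ o
    forward′ (inj₁ v) with forward v
    ... | inj₂ (q′ , h , v′) = inj₂ (q′ , h , inj₁ v′)
    ... | inj₁ (n , at) with change n
    ... | inj₁ same = inj₁ (n , trans same at)
    ... | inj₂ (_ , created _ none _) with () ← trans (sym at) none
    ... | inj₂ (q′ , moved at′ h to _) with refl ← just-injective (trans (sym at) at′) = inj₂ (q′ , h , inj₂ (n , to))

    backward′ : ∀ {q} → Visited′ q → Start q ⊎ ∃ λ p → Hop p q × Visited′ p
    backward′ (inj₁ v) with backward v
    ... | inj₁ st = inj₁ st
    ... | inj₂ (p , h , v′) = inj₂ (p , h , inj₁ v′)
    backward′ (inj₂ (n , to)) with origin to
    ... | stayed at = backward′ (inj₁ (current at))
    ... | new (moved at h _ _) = inj₂ (_ , h , inj₁ (current at))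
    ... | new (created one _ _) = inj₁ (inj₂ one)

    born′ : ∀ {q} → Visited′ q → Start q → T′ q ≢ nothing
    born′ {q} (inj₁ v) st none with change q
    ... | inj₁ same = born v st (trans (sym same) none)
    ... | inj₂ (_ , c) with () ← trans (sym none) (changed-to c)
    born′ (inj₂ (n , to)) st none with origin to
    ... | stayed at = born′ (inj₁ (current at)) st none
    ... | new (moved _ h _ _) = start-no-hop st h
    ... | new (created _ _ to′) with () ← trans (sym none) to′

    -- If `q` was visited before the step, so was `p`; then the token did not just arrive at `p`,
    -- and the old `fresh` applies. If `q` is newly occupied, its token came from `p`, so again no
    -- token has just arrived at `p`, and one that stayed there is the same token by `apart`.
    fresh′ : ∀ {n p q} → T′ n ≡ just p → Hop p q → ¬ Visited′ q
    fresh′ to h (inj₁ v) with origin to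
    ... | stayed at = fresh at h v
    ... | new c = changed-fresh c (visited-backward h v)
    fresh′ to h (inj₂ (_ , to′)) with origin to′
    ... | stayed at′ = fresh′ to h (inj₁ (current at′))
    ... | new (created one _ _) = start-no-hop (inj₂ one) h
    ... | new (moved at′ h′ _ _) with refl ← hop-injective h h′ with origin to
    ... | new c = changed-fresh c (current at′)
    -- The same token now stands on `p` and on `q`, so the hop leads from `p` to itself, against
    -- `fresh`.
    ... | stayed at with refl ← apart at at′ with refl ← just-injective (trans (sym to) to′) = fresh at h (current at)

    apart′ : ∀ {n n′ p} → T′ n ≡ just p → T′ n′ ≡ just p → n ≡ n′
    apart′ to to′ with origin to | origin to′
    ... | stayed at | stayed at′ = apart at at′
    ... | stayed at | new c = ⊥-elim (changed-fresh c (current at))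
    ... | new c | stayed at = ⊥-elim (changed-fresh c (current at))
    ... | new (moved at h _ _) | new (moved at′ h′ _ _) with refl ← hop-injective h h′ = apart at at′
    ... | new (moved _ h _ _) | new (created one _ _) = ⊥-elim (start-no-hop (inj₂ one) h)
    ... | new (created one _ _) | new (moved _ h _ _) = ⊥-elim (start-no-hop (inj₂ one) h)
    ... | new (created _ _ _) | new (created _ _ _) = refl

    synced′ : ∀ {s q q′} → IsSync (link s) → Leave s q → Leave s q′ → Visited′ q → Visited′ q′
    synced′ sy lv lv′ (inj₁ v) = inj₁ (synced sy lv lv′ v)
    synced′ {s} {q} sy lv lv′ (inj₂ (n , to)) with origin to
    ... | stayed at = inj₁ (synced sy lv lv′ (current at))
    ... | new (moved _ _ _ sync′) = inj₂ (sync′ sy lv lv′)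
    ... | new (created one _ _) = ⊥-elim (leave-¬start q sy lv (inj₂ one))

    advance : Σ (Invariant T′) λ I′ → length (Invariant.pending I′) ℕ.< length pending
    advance = record
      { Visited = Visited′ ; visited? = visited′? ; pending = filter unvisited? pending
      ; covers = λ val ¬v → ∈-filter⁺ unvisited? (covers val (¬v ∘ inj₁)) ¬v
      ; current = λ to → inj₂ (_ , to) ; reached = reached′
      ; forward = forward′ ; backward = backward′ ; born = born′ ; initial = inj₁ ∘ initial
      ; fresh = fresh′ ; apart = apart′ ; synced = synced′
      -- The position reached by `progress` was pending and is visited now, so filtering removes it.
      } , filter-notAll unvisited? pending (lose (covers (valid (proj₂ (proj₂ progress))) (changed-fresh c)) (λ ¬v → ¬v (inj₂ (_ , changed-to c))))
      where
      c = proj₂ (proj₂ progress)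
      valid : ∀ {n q} → Changed T T′ n q → Valid q
      valid (moved _ h _ _) = hop-valid h
      valid (created one _ _) = start-valid (inj₂ one)

  -- The invariant in the initial state

  init? : ∀ q → Dec (INIT R q)
  init? (lockPos _ _) = no λ ()
  init? (pos e m) = map′ (λ (c , o) → e , m , refl , c , o) (λ { (_ , _ , refl , c , o) → c , o })
                      (Fin.all? (λ l → ¬? (e ∈? prems (link l))) ×-dec negOcc? (ty e) m)

  module _ {T : State R} (start : IsInitial R T) where

    initial-token : ∀ {n p} → T n ≡ just p → INIT R n × n ≡ p
    initial-token {n} at with init? n
    ... | yes i = i , just-injective (trans (sym (proj₁ (start n) i)) at)
    ... | no ¬i with () ← trans (sym at) (proj₂ (start n) ¬i)

    initial-invariant : Invariant T
    initial-invariant = record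
      { Visited = INIT R ; visited? = init? ; pending = positions
      ; covers = λ val _ → valid⇒∈positions val
      ; current = λ at → let i , eq = initial-token at in subst (INIT R) eq i
      ; reached = λ at → let i , eq = initial-token at in inj₁ i , subst (Star Hop _) eq ε
      ; forward = λ {q} i → inj₁ (q , proj₁ (start q) i)
      ; backward = λ i → inj₁ (inj₁ i)
      ; born = λ {q} i _ none → nothing≢just (trans (sym none) (proj₁ (start q) i))
      ; initial = λ i → i
      ; fresh = λ _ h i → start-no-hop (inj₁ i) h
      ; apart = λ at at′ → trans (proj₂ (initial-token at)) (sym (proj₂ (initial-token at′)))
      ; synced = λ {s} {q} sy lv _ i → ⊥-elim (leave-¬start q sy lv (inj₁ i))
      }
      where
      nothing≢just : ∀ {q : Position R} → nothing ≢ just q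
      nothing≢just ()

  -- Termination and existence of maximal runs

  follow : (st : ℕ → State R) (I : Invariant (st 0)) (k : ℕ) → (∀ i → i ℕ.< k → Step R (st i) (st (suc i))) →
           Σ (Invariant (st k)) λ J → length (Invariant.pending J) ℕ.+ k ℕ.≤ length (Invariant.pending I)
  follow st I zero steps = I , ℕ.≤-reflexive (ℕ.+-identityʳ _)
  follow st I (suc k) steps with J , le ← follow st I k (λ i i<k → steps i (ℕ.m<n⇒m<1+n i<k))
                            with J′ , lt ← advance J (step⇒advance (Invariant.current-valid J) (steps k ℕ.≤-refl)) =
    J′ , ℕ.≤-trans (ℕ.≤-reflexive (ℕ.+-suc _ k)) (ℕ.≤-trans (ℕ.+-monoˡ-≤ k lt) le)

  -- `k` is fuel above the measure: enabled transitions are taken until none is left.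
  maximal : ∀ k {T} (I : Invariant T) → length (Invariant.pending I) ℕ.< k →
            Σ ℕ λ len → Σ (ℕ → State R) λ st → st 0 ≡ T ×
              (∀ i → i ℕ.< len → Step R (st i) (st (suc i))) × (∀ T′ → ¬ Step R (st len) T′)
  maximal (suc k) {T} I (ℕ.s≤s le) with enabled? (Invariant.supported I)
  ... | no stuck = 0 , (λ _ → T) , refl , (λ _ ()) , (λ _ → stuck ∘ step⇒enabled)
  ... | yes en with T′ , step ← enabled⇒step (Invariant.current-valid I) en
               with I′ , lt ← advance I (step⇒advance (Invariant.current-valid I) step)
               with len , st , refl , steps , stuck ← maximal k I′ (ℕ.≤-trans lt le) =
    suc len , (λ { zero → T ; (suc i) → st i }) , refl , (λ { zero _ → step ; (suc i) (ℕ.s≤s lt) → steps i lt }) , stuck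

  ¬infiniteRun : ¬ InfiniteRun R
  -- One step more than the measure of the initial state allows.
  ¬infiniteRun (st , start , steps) with follow st (initial-invariant start) (suc (length positions)) (λ i _ → steps i)
  ... | J , le = ℕ.<-irrefl refl (ℕ.≤-trans (ℕ.m≤n+m _ _) le)

  initialState : State R
  initialState n with init? n
  ... | yes _ = just n
  ... | no _ = nothing

  initialState-initial : IsInitial R initialState
  initialState-initial n with init? n
  ... | yes i = (λ _ → refl) , (λ ¬i → ⊥-elim (¬i i))
  ... | no ¬i = (λ i → ⊥-elim (¬i i)) , (λ _ → refl)

  maximalRun : MaximalRun R
  maximalRun with len , st , eq , steps , stuck ← maximal _ (initial-invariant initialState-initial) ℕ.≤-refl =
    record { len = len ; st = st ; start = subst (IsInitial R) (sym eq) initialState-initial ; steps = steps ; stuck = stuck }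

  -- Nodes of a nesting level

  same-level : ∀ {a b lv} → parent a ≡ lv → parent b ≡ lv → ¬ Inside R a b
  same-level pa pb (here eq) = nestingAcyclic _ (here (trans pb (trans (sym pa) eq)))
  same-level pa pb (there eq i) = nestingAcyclic _ (there (trans pb (trans (sym pa) eq)) i)

  -- `parent` is a function, so the boxes around a link form a chain.
  inside-linear : ∀ {p r r′} → Inside R p r → Inside R p r′ → r ≡ r′ ⊎ Inside R r r′ ⊎ Inside R r′ r
  inside-linear (here eq) j with inside-step eq j
  ... | inj₁ refl = inj₁ refl
  ... | inj₂ k = inj₂ (inj₁ k)
  inside-linear (there eq i) j with inside-step eq j
  ... | inj₁ refl = inj₂ (inj₂ i)
  ... | inj₂ k = inside-linear i k

  -- Distinct representatives of one link would be nested in each other, which nodes of the same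
  -- level never are.
  rep-unique : ∀ {lv p r r′} → Rep R lv p r → Rep R lv p r′ → r ≡ r′
  rep-unique (inj₁ (_ , refl)) (inj₁ (_ , refl)) = refl
  rep-unique (inj₁ (pp , refl)) (inj₂ (pr , i)) = ⊥-elim (same-level pp pr i)
  rep-unique (inj₂ (pr , i)) (inj₁ (pp , refl)) = ⊥-elim (same-level pp pr i)
  rep-unique (inj₂ (pr , i)) (inj₂ (pr′ , j)) with inside-linear i j
  ... | inj₁ eq = eq
  ... | inj₂ (inj₁ k) = ⊥-elim (same-level pr pr′ k)
  ... | inj₂ (inj₂ k) = ⊥-elim (same-level pr′ pr k)

  rep-parent : ∀ {lv p r} → Rep R lv p r → parent r ≡ lv
  rep-parent (inj₁ (pp , refl)) = pp
  rep-parent (inj₂ (pr , _)) = pr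

  Within : Maybe (Fin nL) → Fin nL → Set
  Within nothing _ = ⊤
  Within (just b) l = Inside R l b

  within? : ∀ lv l → Dec (Within lv l)
  within? nothing _ = yes tt
  within? (just b) l = inside? l b

  parent-within : ∀ {lv l} → parent l ≡ lv → Within lv l
  parent-within {nothing} _ = tt
  parent-within {just b} eq = here eq

  rep-within : ∀ {lv p r} → Rep R lv p r → Within lv p
  rep-within (inj₁ (pp , _)) = parent-within pp
  rep-within {nothing} (inj₂ _) = tt
  rep-within {just b} (inj₂ (pr , i)) = inside-trans i (here pr)

  rep-lift : ∀ {lv l c} → parent l ≡ just c → ∃ (Rep R lv c) → ∃ (Rep R lv l)
  rep-lift eq (r , inj₁ (pc , refl)) = r , inj₂ (pc , here eq)
  rep-lift eq (r , inj₂ (pr , i)) = r , inj₂ (pr , there eq i)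

  rep-exists : ∀ lv {l} → Within lv l → ∃ (Rep R lv l)
  rep-exists (just b) {l} (here eq) = l , inj₁ (eq , refl)
  rep-exists (just b) (there eq i) = rep-lift eq (rep-exists (just b) i)
  rep-exists nothing {l} _ = go (inside-noetherian l) refl
    where
    go : ∀ {l lv} → Acc (flip (Inside R)) l → parent l ≡ lv → ∃ (Rep R nothing l)
    go {l} {nothing} _ eq = l , inj₁ (eq , refl)
    go {l} {just c} (acc rec) eq = rep-lift eq (go (rec (here eq)) refl)

  consumer-within : ∀ {lv c p e} → e ∈ prems (link c) → e ∈ concls (link p) → Within lv c → Within lv p
  consumer-within {nothing} _ _ _ = tt
  consumer-within {just b} i j w = boxClosed _ _ _ _ i j w

  ∈-prems : ∀ {l L e} → link l ≡ L → e ∈ prems L → e ∈ prems (link l)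
  ∈-prems refl i = i

  ∈-concls : ∀ {l L e} → link l ≡ L → e ∈ concls L → e ∈ concls (link l)
  ∈-concls refl i = i

  -- Deadlock freedom

  module Stuck {T : State R} (I : Invariant T) (stuck : ¬ Enabled T) where
    open Invariant I

    -- The token that visited `p` must have moved on, or else its move would still be enabled.
    visited-forward : ∀ {p q} (h : Hop p q) → BoxesOpen R T (Hop.via h) → ¬ IsSync (link (Hop.via h)) → Visited p → Visited q
    visited-forward h open′ ns v with forward v
    ... | inj₁ (n , at) = ⊥-elim (stuck (moves _ n at (hop-through h ns) open′))
    ... | inj₂ (_ , h′ , v′) with refl ← hop-functional h h′ = v′

    occurs : Position R → Bool
    occurs p = does (visited? p)

    occurs-visited : ∀ {p} → occurs p ≡ true → Visited p
    occurs-visited {p} eq with visited? p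
    ... | yes v = v

    -- In a stuck state visits spread both ways along the wires of an open link that is no sync
    -- link; this makes the labels of its edges compatible.
    occurs-hop : ∀ {p q} (h : Hop p q) → BoxesOpen R T (Hop.via h) → ¬ IsSync (link (Hop.via h)) → occurs p ≡ occurs q
    occurs-hop {p} {q} h open′ ns =
      does-⇔ (mk⇔ (visited-forward h open′ ns) (visited-backward h)) (visited? p) (visited? q)

    occurs-wire : ∀ {l L x y} → BoxesOpen R T l → link l ≡ L → ¬ IsSync L → Wire L x y → Incoming x ⊎ Outgoing x →
                  occurs (place x) ≡ occurs (place y)
    occurs-wire {l} open′ refl ns w (inj₁ i) = occurs-hop (hop l w i refl refl) open′ ns
    occurs-wire {l} open′ refl ns w (inj₂ o) =
      sym (occurs-hop (hop l (swap w) (Transmits.out⇒in (wire-transmits l w) o) refl refl) open′ ns)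

    -- Where the search for the cause of a missing token has to continue: above the edge
    -- (up), below it (down), or nowhere (ok).
    Λ : Edge → Label
    Λ e = label (ty e) (λ m → occurs (pos e m))

    ok-visited : ∀ {e} m → Λ e ≡ ok → AtomOcc (ty e) m → Visited (pos e m)
    ok-visited {e} m eq o = occurs-visited (label-ok (ty e) m eq o)

    visited-¬down : ∀ {e} → (∀ m → NegOcc (ty e) m → Visited (pos e m)) → Λ e ≢ down
    visited-¬down {e} v = label-¬down (ty e) (λ m o → dec-true (visited? (pos e m)) (v m o))

    visited-¬up : ∀ {e} → (∀ m → PosOcc (ty e) m → Visited (pos e m)) → Λ e ≢ up
    visited-¬up {e} v = label-¬up (ty e) (λ m o → dec-true (visited? (pos e m)) (v m o))

    IsP-¬down : ∀ {e} → IsP (ty e) → Λ e ≢ down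
    IsP-¬down P = visited-¬down λ m o → ⊥-elim (IsP⇒¬NegOcc m P o)

    IsN-¬up : ∀ {e} → IsN (ty e) → Λ e ≢ up
    IsN-¬up N = visited-¬up λ m o → ⊥-elim (IsN⇒¬PosOcc m N o)

    conclusion-¬down : ∀ {e} → IsConclusion R e → Λ e ≢ down
    conclusion-¬down {e} isC = visited-¬down λ m o → initial (e , m , refl , isC , o)

    -- Labels at open links

    Λ-tens : ∀ {l a b c} → BoxesOpen R T l → link l ≡ tensL a b c → Λ c ≡ Λ a ⊗ᴸ Λ b
    Λ-tens {l} {a} {b} {c} open′ eq = trans (cong (λ A → label A (λ m → occurs (pos c m))) (subst (LinkTyped ty) eq (typed l)))
      (sym (cong₂ _⊗ᴸ_ (label-cong (ty a) λ m → occurs-wire open′ eq (λ ()) (inj₁ tens-l))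
                       (label-cong (ty b) λ m → occurs-wire open′ eq (λ ()) (inj₁ tens-r))))

    Λ-par : ∀ {l a b c} → BoxesOpen R T l → link l ≡ parL a b c → Λ c ≡ Λ a ⅋ᴸ Λ b
    Λ-par {l} {a} {b} {c} open′ eq = trans (cong (λ A → label A (λ m → occurs (pos c m))) (subst (LinkTyped ty) eq (typed l)))
      (sym (cong₂ _⅋ᴸ_ (label-cong (ty a) λ m → occurs-wire open′ eq (λ ()) (inj₁ par-l))
                       (label-cong (ty b) λ m → occurs-wire open′ eq (λ ()) (inj₁ par-r))))

    Λ-dual : ∀ {a b} → ty b ≡ dual (ty a) → (∀ m → AtomOcc (ty a) m → occurs (pos a m) ≡ occurs (pos b m)) → Λ b ≡ turned (Λ a)
    Λ-dual {a} {b} t eq = trans (cong (λ A → label A (λ m → occurs (pos b m))) t)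
      (trans (label-dual (ty a) _) (cong turned (sym (label-cong (ty a) eq))))

    Λ-ax : ∀ {l a b} → BoxesOpen R T l → link l ≡ axL a b → Λ b ≡ turned (Λ a)
    Λ-ax {l} open′ eq = Λ-dual (subst (LinkTyped ty) eq (typed l)) λ m o → occurs-wire open′ eq (λ ()) (inj₁ ax) (swap o)

    Λ-cut : ∀ {l a b} → BoxesOpen R T l → link l ≡ cutL a b → Λ b ≡ turned (Λ a)
    Λ-cut {l} open′ eq = Λ-dual (subst (LinkTyped ty) eq (typed l)) λ m o → occurs-wire open′ eq (λ ()) (inj₁ cut) o

    star-backward : ∀ {p q} → Star Hop p q → Visited q → Visited p
    star-backward ε v = v
    star-backward (h ◅ r) v = visited-backward h (star-backward r v)

    -- The token must exist already, or it could be created; wherever it is now, its path began on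
    -- the one link.
    one-visited : ∀ {o e} → BoxesOpen R T o → link o ≡ oneL e → Visited (pos e [])
    one-visited {o} {e} open′ eq with T (pos e []) in at
    ... | nothing = ⊥-elim (stuck (creates o eq at open′))
    ... | just p = star-backward (proj₂ (reached at)) (current at)

    one-¬up : ∀ {o e} → BoxesOpen R T o → link o ≡ oneL e → Λ e ≢ up
    one-¬up {o} {e} open′ eq = visited-¬up at
      where
      at : ∀ m → PosOcc (ty e) m → Visited (pos e m)
      at [] _ = one-visited open′ eq
      at (d ∷ m) a with _ , () , _ ← subst (λ A → PosOcc A (d ∷ m)) (subst (LinkTyped ty) eq (typed o)) a

    lock-IsN : ∀ {b e} → link b ≡ botL e → IsN (ty e)
    lock-IsN {b} eq = subst IsN (sym (subst (LinkTyped ty) eq (typed b))) n-bot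

    -- The atom of the lock was visited, so a token has moved on to index 0; no hop leads on from
    -- there, so that position is still occupied.
    lock-ok : ∀ {b e} → BoxesOpen R T b → link b ≡ botL e → Λ e ≡ ok → Unlocked R T b
    lock-ok {b} {e} open′ eq ok≡
      with h , refl ← through-hop {b} (lock {e = e} eq)
      with forward (visited-forward h open′ (through-¬sync {b} (lock eq))
                     (ok-visited [] ok≡ (inj₂ (Bot , cong (λ A → sub A []) (subst (LinkTyped ty) eq (typed b)) , na-bot))))
    ... | inj₁ (n , at) = e , eq , n , 0 , at
    ... | inj₂ (_ , h′ , _) = ⊥-elim (hop-entry h′)

    -- If one outgoing position is unvisited then, by `synced`, no token has crossed the link; all
    -- its tokens are waiting, and it could fire.
    sync-released : ∀ {s} → BoxesOpen R T s → IsSync (link s) → (∀ q → Entry s q → Visited q) → ∀ q → Leave s q → Visited q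
    sync-released {s} open′ sy full q lv with visited? q
    ... | yes v = v
    ... | no ¬v = ⊥-elim (stuck (syncs s sy open′ occupied))
      where
      occupied : ∀ p → Entry s p → Occupied T p
      occupied p en with forward (full p en)
      ... | inj₁ o = o
      ... | inj₂ (q′ , h , v) with q″ , h′ , refl ← entry-hop s p en with refl ← hop-functional h h′ =
        ⊥-elim (¬v (synced sy (hop-leave h′) lv v))

    Blocked : Edge × Edge → Set
    Blocked (p , c) = (IsP (ty p) × Λ p ≡ up) ⊎ (IsN (ty p) × Λ c ≡ down)

    -- Positive edges are never `down` and negative ones never `up`. So either all in-edges are `ok`
    -- and the link has fired, or an in-edge with a missing token leads the walk on.
    sync-blocked : ∀ {s ps} → BoxesOpen R T s → link s ≡ syncL ps →
                   (∀ q → Leave s q → Visited q) ⊎ Σ (Edge × Edge) λ pc → pc ∈ ps × Blocked pc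
    sync-blocked {s} {ps} open′ eq with search ps (λ i → i)
      where
      search : ∀ qs → (∀ {pc} → pc ∈ qs → pc ∈ ps) →
               (∀ {pc} → pc ∈ qs → ∀ {i o} → InOut R pc i o → Λ i ≡ ok) ⊎ Σ (Edge × Edge) λ pc → pc ∈ ps × Blocked pc
      search [] _ = inj₁ λ ()
      search ((p , c) ∷ qs) sub′ with search qs (sub′ ∘ there)
      ... | inj₂ found = inj₂ found
      ... | inj₁ rest with All.lookup (proj₂ (subst (LinkTyped ty) eq (typed s))) (sub′ (here refl))
      ... | t , inj₁ P with Λ p in Λp
      ... | up = inj₂ (_ , sub′ (here refl) , inj₁ (P , Λp))
      ... | down = ⊥-elim (IsP-¬down P Λp)
      ... | ok = inj₁ λ { (here refl) (inj₁ (_ , refl , refl)) → Λp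
                        ; (here refl) (inj₂ (N , _)) → ⊥-elim (IsP⇒¬IsN P N)
                        ; (there j) → rest j }
      search ((p , c) ∷ qs) sub′ | inj₁ rest | t , inj₂ N with Λ c in Λc
      ... | down = inj₂ (_ , sub′ (here refl) , inj₂ (N , Λc))
      ... | up = ⊥-elim (IsN-¬up (subst IsN t N) Λc)
      ... | ok = inj₁ λ { (here refl) (inj₁ (P , _)) → ⊥-elim (IsP⇒¬IsN P N)
                        ; (here refl) (inj₂ (_ , refl , refl)) → Λc
                        ; (there j) → rest j }
    ... | inj₂ found = inj₂ found
    ... | inj₁ free = inj₁ (sync-released open′ (subst IsSync (sym eq) isSync) full)
      where
      full : ∀ q → Entry s q → Visited q
      full q en with pc , j , i , o , io , m , a , refl ← entry-inout q eq en = ok-visited m (free j io) a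

    -- Edges oriented by their labels

    Consumes : Maybe (Fin nL) → Edge → Fin nL → Set
    Consumes lv e u = e ∈ prems (link u) × parent u ≡ lv

    -- u is the node of level lv from which e hangs; e may come from inside the box of u, but is not
    -- consumed there.
    Produces : Maybe (Fin nL) → Edge → Fin nL → Set
    Produces lv e u = Σ (Fin nL) λ p → e ∈ concls (link p) × Rep R lv p u × (∀ c → e ∈ prems (link c) → ¬ Inside R c u)

    -- An `up` edge is walked from its consumer to its producer and a `down` edge the other way;
    -- `Tail` is the node left and `Head` the node reached.
    data Tail (lv : Maybe (Fin nL)) (e : Edge) (u : Fin nL) : Set where
      up   : Λ e ≡ up → Consumes lv e u → Tail lv e u
      down : Λ e ≡ down → Produces lv e u → Tail lv e u

    data Head (lv : Maybe (Fin nL)) (e : Edge) (u : Fin nL) : Set where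
      up   : Λ e ≡ up → Produces lv e u → Head lv e u
      down : Λ e ≡ down → Consumes lv e u → Head lv e u

    up≢down : ∀ {e} → Λ e ≡ up → Λ e ≢ down
    up≢down u d with () ← trans (sym u) d

    produces-unique : ∀ {lv e u u′} → Produces lv e u → Produces lv e u′ → u ≡ u′
    produces-unique (p , i , r , _) (p′ , i′ , r′ , _) with refl ← producerUnique _ _ _ i i′ = rep-unique r r′

    tail-unique : ∀ {lv e u u′} → Tail lv e u → Tail lv e u′ → u ≡ u′
    tail-unique (up _ (i , _)) (up _ (i′ , _)) = consumerUnique _ _ _ i i′
    tail-unique (up eq _) (down eq′ _) = ⊥-elim (up≢down eq eq′)
    tail-unique (down eq _) (up eq′ _) = ⊥-elim (up≢down eq′ eq)
    tail-unique (down _ p) (down _ p′) = produces-unique p p′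

    tail-head-joins : ∀ {lv e u v} → Tail lv e u → Head lv e v → Joins R lv e u v
    tail-head-joins (up _ (i , pu)) (up _ (p , j , r , _)) = _ , p , i , pu , j , inj₂ (r , refl)
    tail-head-joins (up eq _) (down eq′ _) = ⊥-elim (up≢down eq eq′)
    tail-head-joins (down eq _) (up eq′ _) = ⊥-elim (up≢down eq′ eq)
    tail-head-joins (down _ (p , j , r , _)) (down _ (i , pv)) = _ , p , i , pv , j , inj₁ (r , refl)

    produces-directly : ∀ {lv e u} → e ∈ concls (link u) → parent u ≡ lv → Produces lv e u
    produces-directly {u = u} i pu = u , i , inj₁ (pu , refl) , λ c j k → nestingAcyclic u (boxClosed c u _ u j i k)

    -- A `down` edge along which the walk leaves the level: produced inside, and consumed outside or
    -- not at all.
    Exit : Maybe (Fin nL) → Set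
    Exit lv = Σ Edge λ e → Λ e ≡ down × (Σ (Fin nL) λ p → e ∈ concls (link p) × Within lv p) ×
                (∀ c → e ∈ prems (link c) → ¬ Within lv c)

    exit? : ∀ lv → Dec (Exit lv)
    exit? lv = Fin.any? λ e → label-≟ (Λ e) down ×-dec Fin.any? (λ p → (e ∈? concls (link p)) ×-dec within? lv p)
                 ×-dec Fin.all? (λ c → (e ∈? prems (link c)) →-dec ¬? (within? lv c))

    exit-tail : ∀ {lv b} → parent b ≡ lv → Exit (just b) → Σ Edge λ e → Λ e ≡ down × Produces lv e b
    exit-tail pb (e , eq , (p , i , inside) , outside) = e , eq , p , i , inj₂ (pb , inside) , outside

    -- Every edge has a producer, and boxes are closed upwards, so only a `down` edge can leave the
    -- level.
    travel : ∀ {lv e u} → Tail lv e u → Exit lv ⊎ ∃ (Head lv e)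
    travel {lv} {e} {u} (up eq (i , pu)) with p , j ← producer e
      with r , rep ← rep-exists lv (consumer-within i j (parent-within pu)) =
      inj₂ (r , up eq (p , j , rep , λ c k inside → same-level pu (rep-parent rep)
                                                     (subst (λ c → Inside R c r) (consumerUnique e c u k i) inside)))
    travel {lv} {e} {u} (down eq (p , j , rep , outside)) with Fin.any? (λ c → e ∈? prems (link c))
    ... | no none = inj₁ (e , eq , (p , j , rep-within rep) , λ c i _ → none (c , i))
    ... | yes (c , i) with Maybe.≡-dec Fin._≟_ (parent c) lv
    ... | yes pc = inj₂ (c , down eq (i , pc))
    ... | no ¬pc = inj₁ (e , eq , (p , j , rep-within rep) , leaves)
      where
      leaves : ∀ c′ → e ∈ prems (link c′) → ¬ Within lv c′
      -- If the consumer lay deeper in a box of the level, so would the producer; that box would be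
      -- the node from which `e` hangs, which `outside` excludes.
      leaves c′ i′ w with refl ← consumerUnique e _ _ i i′ with rep-exists lv w
      ... | _ , inj₁ (pc , _) = ¬pc pc
      ... | r , inj₂ (pr , inside) with refl ← rep-unique rep (inj₂ (pr , boxClosed c p e r i j inside)) =
        outside c i inside

    record Departure (lv : Maybe (Fin nL)) (u : Fin nL) : Set where
      constructor depart
      field
        edge   : Edge
        tail   : Tail lv edge u
        -- A ⅋ link left upwards was entered through its conclusion, so a cycle never uses both premisses.
        par-up : ∀ {a b c} → link u ≡ parL a b c → Λ edge ≡ up → Λ c ≡ up

    depart-down : ∀ {lv u e} → Λ e ≡ down → Produces lv e u → Departure lv u
    depart-down eq p = depart _ (down eq p) λ _ eq′ → ⊥-elim (up≢down eq′ eq)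

    -- Continuing the walk at a node

    module Turn {lv : Maybe (Fin nL)} {u : Fin nL} (pu : parent u ≡ lv) (open′ : BoxesOpen R T u) where

      out-down : ∀ {L e} → link u ≡ L → e ∈ concls L → Λ e ≡ down → Departure lv u
      out-down refl i eq = depart-down eq (produces-directly i pu)

      out-up : ∀ {L e} → link u ≡ L → e ∈ prems L → (∀ {a b c} → L ≡ parL a b c → Λ c ≡ up) → Λ e ≡ up → Departure lv u
      out-up refl i par eq = depart _ (up eq (i , pu)) λ eq′ _ → par eq′

      turn-sync : ∀ {ps} → link u ≡ syncL ps → (∀ q → Leave u q → Visited q) ⊎ Departure lv u
      turn-sync eq with sync-blocked open′ eq
      ... | inj₁ released = inj₁ released
      ... | inj₂ (_ , j , inj₁ (_ , Λp)) = inj₂ (out-up eq (∈-map⁺ proj₁ j) (λ ()) Λp)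
      ... | inj₂ (_ , j , inj₂ (_ , Λc)) = inj₂ (out-down eq (∈-map⁺ proj₂ j) Λc)

      -- A cut sends the walk up its other edge, a ⅋ sends it down, a ⊗ either down or up the other
      -- premiss, and a sync link out through a blocked in-edge.
      turn-down : ∀ {L e} → link u ≡ L → e ∈ prems L → Λ e ≡ down → Departure lv u
      turn-down {cutL a b} eq (here refl) d = out-up eq (there (here refl)) (λ ()) (trans (Λ-cut open′ eq) (cong turned d))
      turn-down {cutL a b} eq (there (here refl)) d with Λ a in Λa | trans (sym d) (Λ-cut open′ eq)
      ... | up | _ = out-up eq (here refl) (λ ()) Λa
      turn-down {tensL a b c} eq (here refl) d with ⊗-downˡ (Λ b)
      ... | inj₁ dn = out-down eq (here refl) (trans (Λ-tens open′ eq) (trans (cong (_⊗ᴸ Λ b) d) dn))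
      ... | inj₂ Λb = out-up eq (there (here refl)) (λ ()) Λb
      turn-down {tensL a b c} eq (there (here refl)) d with ⊗-downʳ (Λ a)
      ... | inj₁ dn = out-down eq (here refl) (trans (Λ-tens open′ eq) (trans (cong (Λ a ⊗ᴸ_) d) dn))
      ... | inj₂ Λa = out-up eq (here refl) (λ ()) Λa
      turn-down {parL a b c} eq (here refl) d =
        out-down eq (here refl) (trans (Λ-par open′ eq) (cong (_⅋ᴸ Λ b) d))
      turn-down {parL a b c} eq (there (here refl)) d =
        out-down eq (here refl) (trans (Λ-par open′ eq) (trans (cong (Λ a ⅋ᴸ_) d) (⅋-downʳ (Λ a))))
      turn-down {syncL ps} eq i d with turn-sync eq
      ... | inj₂ dep = dep
      ... | inj₁ released = ⊥-elim (visited-¬down (λ m o → released _ (inj₂ (o , ∈-prems eq i))) d)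

      -- An axiom sends the walk down its other conclusion, ⊗ and ⅋ send it further up. It cannot
      -- end here: the token of an open one link exists, and a lock is negative.
      turn-up : ∀ {L e} → link u ≡ L → e ∈ concls L → Λ e ≡ up → Departure lv u
      turn-up {axL a b} eq (here refl) Λa = out-down eq (there (here refl)) (trans (Λ-ax open′ eq) (cong turned Λa))
      turn-up {axL a b} eq (there (here refl)) Λb with Λ a in Λa | trans (sym Λb) (Λ-ax open′ eq)
      ... | down | _ = out-down eq (here refl) Λa
      turn-up {tensL a b c} eq (here refl) Λc with ⊗-up (Λ a) (Λ b) (trans (sym (Λ-tens open′ eq)) Λc)
      ... | inj₁ Λa = out-up eq (here refl) (λ ()) Λa
      ... | inj₂ Λb = out-up eq (there (here refl)) (λ ()) Λb
      turn-up {parL a b c} eq (here refl) Λc with ⅋-up (Λ a) (Λ b) (trans (sym (Λ-par open′ eq)) Λc)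
      ... | inj₁ Λa = out-up eq (here refl) (λ { refl → Λc }) Λa
      ... | inj₂ Λb = out-up eq (there (here refl)) (λ { refl → Λc }) Λb
      turn-up {oneL e} eq (here refl) Λe = ⊥-elim (one-¬up open′ eq Λe)
      turn-up {botL e} eq (here refl) Λe = ⊥-elim (IsN-¬up (lock-IsN eq) Λe)
      turn-up {syncL ps} eq i Λe with turn-sync eq
      ... | inj₂ dep = dep
      ... | inj₁ released = ⊥-elim (visited-¬up (λ m o → released _ (inj₁ (o , ∈-concls eq i))) Λe)

    Exits : Maybe (Fin nL) → Set
    Exits lv = OpenLevel T lv → ∀ {e u} → Head lv e u → Exit lv

    openLevel-open : ∀ {lv l} → OpenLevel T lv → parent l ≡ lv → BoxesOpen R T l
    openLevel-open {l = l} o refl = openLevel⇒boxesOpen l o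

    inner-head : ∀ {e u p} → Λ e ≡ up → e ∈ concls (link p) → Inside R p u → (∀ c → e ∈ prems (link c) → ¬ Inside R c u) →
                 ∃ (Head (just u) e)
    inner-head eq j inside outside with r , rep ← rep-exists (just _) inside =
      r , up eq (_ , j , rep , λ c k inside′ → outside c k (inside-trans inside′ (here (rep-parent rep))))

    -- At the node of a box the lock decides: a `down` lock is the way out, while an `ok` lock means
    -- that the box is unlocked and is crossed by the induction hypothesis `boxes`.
    turn : ∀ {lv} → (∀ b → parent b ≡ lv → Exits (just b)) → OpenLevel T lv → ∀ {e u} → Head lv e u → Departure lv u
    turn boxes o (down eq (i , pu)) = Turn.turn-down pu (openLevel-open o pu) refl i eq
    turn boxes o (up eq (p , j , inj₁ (pp , refl) , _)) = Turn.turn-up pp (openLevel-open o pp) refl j eq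
    turn boxes o {u = u} (up eq (p , j , inj₂ (pu , inside) , outside)) with parentOf inside
      where
      parentOf : ∀ {l b} → Inside R l b → IsBotLink R b
      parentOf (here eq) = parentBot _ _ eq
      parentOf (there _ i) = parentOf i
    ... | k , bot with Λ k in Λk
    ... | up = ⊥-elim (IsN-¬up (lock-IsN bot) Λk)
    ... | down = Turn.out-down pu (openLevel-open o pu) bot (here refl) Λk
    ... | ok with open′ ← openLevel-open o pu
             with _ , head ← inner-head eq j inside outside
             with e′ , d , prod ← exit-tail pu (boxes u pu (lock-ok open′ bot Λk , open′) head) = depart-down d prod

    -- The switching cycle of an endless walk

    module Walk {lv : Maybe (Fin nL)} (boxes : ∀ b → parent b ≡ lv → Exits (just b)) (o : OpenLevel T lv) (¬exit : ¬ Exit lv) where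
      open Departure

      Stage : Set
      Stage = ∃ (Departure lv)

      arrival : (d : Stage) → ∃ (Head lv (edge (proj₂ d)))
      arrival (_ , d) with travel (tail d)
      ... | inj₁ exit = ⊥-elim (¬exit exit)
      ... | inj₂ head = head

      next : Stage → Stage
      next d = proj₁ (arrival d) , turn boxes o (proj₂ (arrival d))

      module _ (d₀ : Stage) where

        stage : ℕ → Stage
        stage zero = d₀
        stage (suc k) = next (stage k)

        nodeAt : ℕ → Fin nL
        nodeAt k = proj₁ (stage k)

        edgeAt : ℕ → Edge
        edgeAt k = edge (proj₂ (stage k))

        tailAt : ∀ k → Tail lv (edgeAt k) (nodeAt k)
        tailAt k = tail (proj₂ (stage k))

        headAt : ∀ k → Head lv (edgeAt k) (nodeAt (suc k))
        headAt k = proj₂ (arrival (stage k))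

        premise-end : ∀ k {l} → edgeAt k ∈ prems (link l) →
                      (Λ (edgeAt k) ≡ up × nodeAt k ≡ l) ⊎ (Λ (edgeAt k) ≡ down × nodeAt (suc k) ≡ l)
        premise-end k i with tailAt k | headAt k
        ... | up eq (j , _) | _ = inj₁ (eq , consumerUnique _ _ _ j i)
        ... | down eq _ | down _ (j , _) = inj₂ (eq , consumerUnique _ _ _ j i)
        ... | down eq _ | up eq′ _ = ⊥-elim (up≢down eq′ eq)

        -- By the polarity of its formula, an out-edge is always walked towards its sync link. A
        -- cycle enters each node once and so uses at most one of them.
        sync-head : ∀ k {s} → parent s ≡ lv → OutEdgeOf R s (edgeAt k) → nodeAt (suc k) ≡ s
        sync-head k {s} ps≡ (ps , eq , (p , c) , j , _ , io) with headAt k | io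
        ... | down d _ | inj₁ (P , _ , refl) =
          ⊥-elim (IsP-¬down (subst IsP (proj₁ (All.lookup (proj₂ (subst (LinkTyped ty) eq (typed s))) j)) P) d)
        ... | up u (_ , i , rep , _) | inj₁ (P , _ , refl)
          with refl ← producerUnique _ _ _ i (∈-concls eq (∈-map⁺ proj₂ j)) = rep-unique rep (inj₁ (ps≡ , refl))
        ... | up u _ | inj₂ (N , _ , refl) = ⊥-elim (IsN-¬up N u)
        ... | down d (i , _) | inj₂ (N , _ , refl) = consumerUnique _ _ _ i (∈-prems eq (∈-map⁺ proj₁ j))

        par-down : ∀ {l a b c e} → parent l ≡ lv → link l ≡ parL a b c → e ∈ (a ∷ b ∷ []) → Λ e ≡ down → Λ c ≡ down
        par-down {b = b} pl eq (here refl) d = trans (Λ-par (openLevel-open o pl) eq) (cong (_⅋ᴸ Λ b) d)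
        par-down {a = a} pl eq (there (here refl)) d =
          trans (Λ-par (openLevel-open o pl) eq) (trans (cong (Λ a ⅋ᴸ_) d) (⅋-downʳ (Λ a)))

        -- Leaving a ⅋ upwards needs its conclusion to be `up`; a premiss walked downwards makes it
        -- `down`.
        par-conflict : ∀ x y {l a b c} → link l ≡ parL a b c → edgeAt y ∈ (a ∷ b ∷ []) →
                       Λ (edgeAt x) ≡ up → nodeAt x ≡ l → Λ (edgeAt y) ≢ down
        par-conflict x y eq i u refl d =
          up≢down (par-up (proj₂ (stage x)) eq u) (par-down (tail-parent (tailAt x)) eq i d)
          where
          tail-parent : ∀ {e u} → Tail lv e u → parent u ≡ lv
          tail-parent (up _ (_ , pu)) = pu
          tail-parent (down _ (_ , _ , rep , _)) = rep-parent rep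

        cycle : SwitchingCycle R lv
        cycle with i , len , closed , inj ← firstRepeat nodeAt = record
          { len = len ; edge = λ x → edgeAt (x ℕ.+ i) ; node = λ x → nodeAt (x ℕ.+ i)
          ; joins = λ x _ → tail-head-joins (tailAt (x ℕ.+ i)) (headAt (x ℕ.+ i))
          ; closed = closed
          -- An edge determines its tail, so equal edges give equal nodes.
          ; distinct = λ x y x≤ y≤ eq → inj x≤ y≤ (tail-unique (tailAt (x ℕ.+ i)) (subst (λ e → Tail lv e _) (sym eq) (tailAt (y ℕ.+ i))))
          ; parSwitch = parSwitch
          ; syncSwitch = λ x y s x≤ y≤ ps≡ oe oe′ → rotate x≤ y≤ (trans (sync-head (x ℕ.+ i) ps≡ oe) (sym (sync-head (y ℕ.+ i) ps≡ oe′)))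
          }
          where
          -- The heads are the nodes shifted by one; at `len` the shift wraps round to node 0 by
          -- `closed`.
          rotate : ∀ {x y} → x ℕ.≤ len → y ℕ.≤ len → nodeAt (suc x ℕ.+ i) ≡ nodeAt (suc y ℕ.+ i) → x ≡ y
          rotate {x} {y} x≤ y≤ eq with ℕ.m≤n⇒m<n∨m≡n x≤ | ℕ.m≤n⇒m<n∨m≡n y≤
          ... | inj₁ x< | inj₁ y< = ℕ.suc-injective (inj x< y< eq)
          ... | inj₂ refl | inj₂ refl = refl
          ... | inj₁ x< | inj₂ refl with () ← inj x< ℕ.z≤n (trans eq closed)
          ... | inj₂ refl | inj₁ y< with () ← inj y< ℕ.z≤n (trans (sym eq) closed)

          parSwitch : ∀ x y l a b c → x ℕ.≤ len → y ℕ.≤ len → link l ≡ parL a b c →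
                      edgeAt (x ℕ.+ i) ∈ (a ∷ b ∷ []) → edgeAt (y ℕ.+ i) ∈ (a ∷ b ∷ []) → x ≡ y
          parSwitch x y l a b c x≤ y≤ eq j k
            with premise-end (x ℕ.+ i) (∈-prems eq j)
               | premise-end (y ℕ.+ i) (∈-prems eq k)
          ... | inj₁ (_ , nx) | inj₁ (_ , ny) = inj x≤ y≤ (trans nx (sym ny))
          ... | inj₂ (_ , nx) | inj₂ (_ , ny) = rotate x≤ y≤ (trans nx (sym ny))
          ... | inj₁ (u , nx) | inj₂ (d , _) = ⊥-elim (par-conflict (x ℕ.+ i) (y ℕ.+ i) eq k u nx d)
          ... | inj₂ (d , _) | inj₁ (u , ny) = ⊥-elim (par-conflict (y ℕ.+ i) (x ℕ.+ i) eq j u ny d)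

    -- Exits by induction on nesting

    level-exits : ∀ {lv} → (∀ b → parent b ≡ lv → Exits (just b)) → Exits lv
    level-exits {lv} boxes o head with exit? lv
    ... | yes exit = exit
    -- Without an exit the walk never ends and closes a cycle that correctness forbids.
    ... | no ¬exit = ⊥-elim (correct lv (Walk.cycle boxes o ¬exit (_ , turn boxes o head)))

    box-exits : ∀ b → Exits (just b)
    box-exits b = go (inside-wellFounded b)
      where
      go : ∀ {b} → Acc (Inside R) b → Exits (just b)
      go (acc rec) = level-exits λ c pc → go (rec (here pc))

    exits : ∀ {lv} → Exits lv
    exits = level-exits λ b _ → box-exits b

    tail-exit : ∀ {lv e u} → OpenLevel T lv → Tail lv e u → Exit lv
    tail-exit o t with travel t
    ... | inj₁ exit = exit
    ... | inj₂ (_ , head) = exits o head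

    -- Seen from outside, an exit of a box hangs from the node of its bot link, and the walk from
    -- there has to leave the outer level too.
    exit-outward : ∀ {lv b} → parent b ≡ lv → OpenLevel T (just b) → Exit (just b) → OpenLevel T lv × Exit lv
    exit-outward {b = b} refl (_ , open′) exit with o ← boxesOpen⇒openLevel b open′ with e , d , prod ← exit-tail refl exit =
      o , tail-exit o (down d prod)

    ¬exit-outermost : ¬ Exit nothing
    ¬exit-outermost (e , d , _ , outside) = conclusion-¬down (λ c i → outside c i tt) d

    -- An exit is passed on outwards to depth 0, where it would be a `down` conclusion of the net.
    ¬exit : ∀ lv → OpenLevel T lv → ¬ Exit lv
    ¬exit nothing _ = ¬exit-outermost
    ¬exit (just b) = go (inside-noetherian b) refl
      where
      go : ∀ {b lv} → Acc (flip (Inside R)) b → parent b ≡ lv → OpenLevel T (just b) → ¬ Exit (just b)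
      go {lv = nothing} _ pb o exit = ¬exit-outermost (proj₂ (exit-outward pb o exit))
      go {lv = just c} (acc rec) pb o exit =
        let o′ , exit′ = exit-outward pb o exit in go (rec (here pb)) refl o′ exit′

    -- Stuck states are final

    unlocked : ∀ {b} → IsBotLink R b → BoxesOpen R T b → Unlocked R T b
    unlocked {b} (e , bot) open′ with o ← boxesOpen⇒openLevel b open′ with Λ e in Λe
    ... | ok = lock-ok open′ bot Λe
    ... | up = ⊥-elim (IsN-¬up (lock-IsN bot) Λe)
    -- A `down` lock would start a walk out of its open level.
    ... | down = ⊥-elim (¬exit _ o (tail-exit o (down Λe (produces-directly (∈-concls bot (here refl)) refl))))

    boxesOpen : ∀ l → BoxesOpen R T l
    boxesOpen l = go (inside-noetherian l)
      where
      go : ∀ {l} → Acc (flip (Inside R)) l → BoxesOpen R T l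
      go (acc rec) b (here eq) = unlocked (parentBot _ b eq) (go (rec (here eq)))
      go (acc rec) b (there eq i) = go (rec (here eq)) b i

    Λ-ok : ∀ e → Λ e ≡ ok
    Λ-ok e with p , i ← producer e with o ← boxesOpen⇒openLevel p (boxesOpen p) with Λ e in eq
    ... | ok = refl
    ... | up = ⊥-elim (¬exit _ o (exits o (up eq (produces-directly i refl))))
    ... | down = ⊥-elim (¬exit _ o (tail-exit o (down eq (produces-directly i refl))))

    all-visited : ∀ {e m} → AtomOcc (ty e) m → Visited (pos e m)
    all-visited {e} {m} a = ok-visited m (Λ-ok e) a

    start-present : ∀ {n} → Start n → T n ≢ nothing
    start-present st = born (visited st) st
      where
      visited : ∀ {q} → Start q → Visited q
      visited (inj₁ i) = initial i
      visited st@(inj₂ (_ , _ , _ , refl)) with atom a ← start-valid st = all-visited a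

    -- A hop through an ordinary link would be an enabled move; one through a sync link would lead
    -- to a visited position, against `fresh`.
    settled : ∀ {n p q} → T n ≡ just p → ¬ Hop p q
    settled {n} at h with isSync? (link (Hop.via h)) | hop-valid h
    ... | no ns | _ = stuck (moves _ n at (hop-through h ns) (boxesOpen _))
    ... | yes _ | atom a = fresh at h (all-visited a)
    ... | yes sy | lock _ with () ← subst IsSync (hop-leave h) sy

    final : IsFinal R T
    final = ended , reaches
      where
      ended : ∀ n p → T n ≡ just p → FIN R p ⊎ BOTBOX R p
      ended n p at with current-valid at
      ... | lock {b} {e} eq = inj₂ (b , e , 0 , eq , refl)
      ... | atom {e} {m} (inj₂ a) with l , i ← producer e =
        ⊥-elim (settled at (proj₁ (proj₂ (entry-hop l (pos e m) (inj₂ (a , i))))))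
      ... | atom {e} {m} (inj₁ a) with Fin.any? (λ c → e ∈? prems (link c))
      ... | no none = inj₁ (e , m , refl , (λ c i → none (c , i)) , a)
      ... | yes (c , i) = ⊥-elim (settled at (proj₁ (proj₂ (entry-hop c (pos e m) (inj₁ (a , i))))))

      reaches : ∀ p → FIN R p → Occupied T p
      reaches _ (e , m , refl , isC , a) with forward (all-visited (inj₁ a))
      ... | inj₁ o = o
      ... | inj₂ (_ , h , _) with hop-entry h
      ... | inj₁ (_ , i) = ⊥-elim (isC _ i)
      ... | inj₂ (neg , _) = ⊥-elim (polarity-exclusive (ty e) m a neg)

  -- Uniqueness of the final state

  star-end-unique : ∀ {n p p′} → Star Hop n p → Star Hop n p′ → (∀ {q} → ¬ Hop p q) → (∀ {q} → ¬ Hop p′ q) → p ≡ p′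
  star-end-unique ε ε _ _ = refl
  star-end-unique ε (h ◅ _) end _ = ⊥-elim (end h)
  star-end-unique (h ◅ _) ε _ end = ⊥-elim (end h)
  star-end-unique (h ◅ r) (h′ ◅ r′) end end′ with refl ← hop-functional h h′ = star-end-unique r r′ end end′

  -- In both states the tokens are exactly those named by starting positions, and each stands at the
  -- end of the one maximal path from there.
  stuck-unique : ∀ {T T′} → Invariant T → Invariant T′ → ¬ Enabled T → ¬ Enabled T′ → ∀ n → T n ≡ T′ n
  stuck-unique {T} {T′} I I′ stuck stuck′ n with T n in at | T′ n in at′
  ... | nothing | nothing = refl
  ... | just _ | nothing = ⊥-elim (Stuck.start-present I′ stuck′ (proj₁ (Invariant.reached I at)) at′)
  ... | nothing | just _ = ⊥-elim (Stuck.start-present I stuck (proj₁ (Invariant.reached I′ at′)) at)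
  ... | just _ | just _ = cong just (star-end-unique (proj₂ (Invariant.reached I at)) (proj₂ (Invariant.reached I′ at′))
                                       (Stuck.settled I stuck at) (Stuck.settled I′ stuck′ at′))

  module _ (ρ : MaximalRun R) where
    open MaximalRun ρ

    last-invariant : Invariant (lastState R ρ)
    last-invariant = proj₁ (follow st (initial-invariant start) len steps)

    last-stuck : ¬ Enabled (lastState R ρ)
    last-stuck en with T′ , step ← enabled⇒step (Invariant.current-valid last-invariant) en = stuck T′ step

mainTheorem11 : (R : Net) → IsSMLLNet R →
    Σ (State R) λ F → IsFinal R F × ¬ InfiniteRun R ×
    Σ (MaximalRun R) (λ ρ → ∀ n → lastState R ρ n ≡ F n) ×
    ((ρ : MaximalRun R) → ∀ n → lastState R ρ n ≡ F n)
mainTheorem11 R isNet =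
  lastState R maximalRun , Stuck.final (last-invariant maximalRun) (last-stuck maximalRun) , ¬infiniteRun ,
  (maximalRun , λ _ → refl) ,
  λ ρ → stuck-unique (last-invariant ρ) (last-invariant maximalRun) (last-stuck ρ) (last-stuck maximalRun)
  where open Machine R isNet
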